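{- For every integer $n\ge 1$, \[ \binom{n+1}{2}F_n(z)=\sum_{\substack{1\le k\le n+1\\ k\equiv n \pmod 2}} {n+1\brack k}\, z^{\lfloor (k-1)/2\rfloor}. \]
   Context: $\mathfrak{S}_n$ is the symmetric group on $\{1,\dots,n\}$, $Q_n\subseteq\mathfrak{S}_n$ is the set of $n$-cycles, and $c(\eta)$ denotes the number of cycles (including fixed points) of a permutation $\eta$. Permutations are multiplied from left to right. For $\pi\in\mathfrak{S}_n$, $F_\pi(z)=\sum_{\zeta\in Q_n} z^{\lfloor (c(\zeta\pi)-1)/2\rfloor}$; this depends only on the cycle type of $\pi$. $F_n(z)$ denotes $F_\pi(z)$ for $\pi$ an $n$-cycle (e.g. $\pi=(1\,2\,\cdots\,n)$). ${m\brack k}$ denotes the signless Stirling number of the first kind, the number of permutations in $\mathfrak{S}_m$ with exactly $k$ cycles. -}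

module Defs where

open import Data.Nat using (ℕ; zero; suc; _+_; _*_; _∸_; _≡ᵇ_; _≤ᵇ_)
open import Data.Nat.DivMod using (_/_; _%_)
open import Data.Fin using (Fin; toℕ)
open import Data.Fin.Properties using (_≟_)
open import Data.Vec using (Vec; []; _∷_; lookup; allFin; toList)
open import Data.List using (List; []; _∷_; map; concatMap; upTo; foldr)
open import Data.Bool using (Bool; true; false; if_then_else_; _∧_; _∨_; not)
open import Relation.Nullary.Decidable using (⌊_⌋)

count : {A : Set} → (A → Bool) → List A → ℕ
count p [] = 0
count p (x ∷ xs) = (if p x then 1 else 0) + count p xs

allB : {A : Set} → (A → Bool) → List A → Bool
allB p [] = true
allB p (x ∷ xs) = p x ∧ allB p xs

filterB : {A : Set} → (A → Bool) → List A → List A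
filterB p [] = []
filterB p (x ∷ xs) = if p x then x ∷ filterB p xs else filterB p xs

vecs : {A : Set} → List A → (n : ℕ) → List (Vec A n)
vecs xs zero = [] ∷ []
vecs xs (suc n) = concatMap (λ x → map (x ∷_) (vecs xs n)) xs

elems : (n : ℕ) → List (Fin n)
elems n = toList (allFin n)

allMaps : (n : ℕ) → List (Fin n → Fin n)
allMaps n = map (λ v i → lookup v i) (vecs (elems n) n)

isPerm : {n : ℕ} → (Fin n → Fin n) → Bool
isPerm {n} σ = allB (λ i → allB (λ j → not ⌊ σ i ≟ σ j ⌋ ∨ ⌊ i ≟ j ⌋) (elems n)) (elems n)

Sym : (n : ℕ) → List (Fin n → Fin n)
Sym n = filterB isPerm (allMaps n)

iter : {n : ℕ} → (Fin n → Fin n) → ℕ → Fin n → Fin n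
iter σ zero i = i
iter σ (suc m) i = σ (iter σ m i)

isOrbitMin : {n : ℕ} → (Fin n → Fin n) → Fin n → Bool
isOrbitMin {n} σ i = allB (λ m → toℕ i ≤ᵇ toℕ (iter σ m i)) (upTo n)

-- c(σ): number of cycles (including fixed points) = number of orbit minima
cycles : {n : ℕ} → (Fin n → Fin n) → ℕ
cycles {n} σ = count (isOrbitMin σ) (elems n)

Q : (n : ℕ) → List (Fin n → Fin n)
Q n = filterB (λ ζ → cycles ζ ≡ᵇ 1) (Sym n)

_·_ : {n : ℕ} → (Fin n → Fin n) → (Fin n → Fin n) → (Fin n → Fin n)
(ζ · π) i = π (ζ i)

-- polynomials in z with ℕ coefficients, as coefficient sequences
Poly : Set
Poly = ℕ → ℕ

zeroP : Poly
zeroP _ = 0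

_+P_ : Poly → Poly → Poly
(p +P q) j = p j + q j

_*P_ : ℕ → Poly → Poly
(a *P p) j = a * p j

zpow : ℕ → Poly
zpow d j = if d ≡ᵇ j then 1 else 0

sumP : List Poly → Poly
sumP = foldr _+P_ zeroP

F : {n : ℕ} → (Fin n → Fin n) → Poly
F {n} π = sumP (map (λ ζ → zpow ((cycles (ζ · π) ∸ 1) / 2)) (Q n))

stirling1 : ℕ → ℕ → ℕ
stirling1 m k = count (λ σ → cycles σ ≡ᵇ k) (Sym m)

RHS : ℕ → Poly
RHS n = sumP (map (λ k → stirling1 (suc n) k *P zpow ((k ∸ 1) / 2))
                  (filterB (λ k → (1 ≤ᵇ k) ∧ (k % 2 ≡ᵇ n % 2)) (upTo (n + 2))))

{-# OPTIONS --safe #-}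
-- Fix an integer q and let X S be the sum of ε ζ S · q^c(π ∘ ζ) over all permutations ζ, where
-- ε ζ S = (-1)^(number of cycles of ζ inside S) if S is ζ-invariant and 0 otherwise.
-- Cancellation over the unions of cycles of ζ missing the point 0 shows that the sum of ε ζ S
-- over the sets S ∌ 0 is 1 if ζ is a long cycle and 0 otherwise, so the sum of q^c(π ∘ ζ) over
-- the long cycles ζ is the sum of X S over those S.
--
-- If two points a, b of S leave S under π, then ζ ↦ (a b) ∘ ζ ∘ (π a  π b) conjugates π ∘ ζ and
-- changes the sign of ε, so X S = 0.  For the long cycle π only S = ∅ and the arcs of π
-- survive; deleting points one at a time gives X ∅ = q (q + 1) ⋯ (q + n - 1) and, for an arc
-- of size k, X S = - (q - k + 1) ⋯ (q - k + n - 1).  There are n - k arcs of size k avoiding 0,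
-- and two telescoping summations yield
--   n (n + 1) ∑_ζ q^c(π ∘ ζ) = q (q + 1) ⋯ (q + n) - q (q - 1) ⋯ (q - n)   (ζ long cycles).
-- On the right the coefficient of q^k is 2 [n+1, k] if k ≡ n (mod 2), and 0 otherwise.
module Submission where

open import Defs
open import Data.Bool using (Bool; true; false; T; if_then_else_; _∧_; _∨_; not)
import Data.Bool.Properties as Bool
open import Data.Fin using (Fin; zero; suc; fromℕ; inject₁; lift; opposite; punchOut; toℕ; _↑ʳ_; _↑ˡ_)
open import Data.Fin.Induction using (>-weakInduction)
open import Data.Fin.Permutation using (permutation)
open import Data.Fin.Permutation.Components using (transpose)
open import Data.Fin.Properties using (_≟_; 0≢1+n; all?; any?; fromℕ≢inject₁; inject₁-injective; injective⇒≤; opposite-involutive; opposite-prop; pigeonhole; punchOut-injective; suc-injective; toℕ-fromℕ; toℕ-injective; toℕ-inject₁; toℕ-↑ʳ; toℕ-↑ˡ; toℕ≤pred[n])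
open import Data.Integer as ℤ using (ℤ; -_; 0ℤ; 1ℤ; -1ℤ; _+_; _*_; _-_; _^_) renaming (+_ to pos)
import Data.Integer.Properties as ℤ
open import Data.Integer.Tactic.RingSolver using (solve-∀)
open import Data.List using (List; []; _∷_; _++_; applyUpTo; concatMap; map; upTo)
open import Data.List.Relation.Unary.All as All using (All; []; _∷_)
open import Data.Nat as ℕ using (ℕ; zero; suc; _≥_; _≤ᵇ_; _≡ᵇ_)
open import Data.Nat.Combinatorics using (_C_; nC1≡n; nCk+nC[k+1]≡[n+1]C[k+1])
open import Data.Nat.DivMod using (_/_; _%_; m%n<n; m≡m%n+[m/n]*n)
import Data.Nat.Properties as ℕ
open import Data.Product using (∃; _×_; _,_; proj₁; proj₂)
open import Data.Sum using (_⊎_; inj₁; inj₂)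
open import Data.Unit using (⊤; tt)
open import Data.Vec using (Vec; []; _∷_; lookup; tabulate; toList)
open import Function using (_∘_; id)
open import Relation.Binary.Definitions using (DecidableEquality; tri<; tri≈; tri>)
open import Relation.Binary.PropositionalEquality
open import Relation.Nullary using (¬_; Dec; yes; no; does; contradiction)
open import Relation.Nullary.Decidable using (⌊_⌋; dec-true; dec-false)
open import Algebra.Properties.CommutativeMonoid.Sum ℤ.*-1-commutativeMonoid using () renaming (sum to ∏; sum-permute to ∏-permute)

-- Being a long cycle is hard to follow through a product with π. The signs ε let ζ run over the
-- whole group instead, where translation and insertion of a point are available; this is why X,
-- rather than the sum over long cycles, is computed. The cycle count and ε are both defined by
-- deleting the point 0, so deletion steps hold almost by computation. The price is that invariance
-- under relabelling is hidden. For ε it holds because the effect of transpositions within S or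
-- within its complement determines ε; for the cycle count, because the sum of ε² over all S is 2 to
-- that count. As 0 lies outside S, the arcs of i ↦ i - 1 are runs of 1s in a word of length n - 1
-- and never wrap around. Other long cycles are reached by conjugation. Only one parity of k
-- survives because q (q - 1) ⋯ (q - n) is (-1)^(n+1) times the rising product at -q. The identity
-- is proved at every integer q, and the coefficients are recovered from those values. The product
-- `ζ · π`, read from left to right, is the composite π ∘ ζ.

private variable
  A B : Set
  n : ℕ

-- Finite sums of integers

∑ : List A → (A → ℤ) → ℤ
∑ [] f = 0ℤ
∑ (x ∷ xs) f = f x + ∑ xs f

∑-cong-All : {P : A → Set} {f g : A → ℤ} {xs : List A} →
  All P xs → (∀ x → P x → f x ≡ g x) → ∑ xs f ≡ ∑ xs g
∑-cong-All [] h = refl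
∑-cong-All (p ∷ ps) h = cong₂ _+_ (h _ p) (∑-cong-All ps h)

∑-cong : (xs : List A) {f g : A → ℤ} → (∀ x → f x ≡ g x) → ∑ xs f ≡ ∑ xs g
∑-cong [] h = refl
∑-cong (x ∷ xs) h = cong₂ _+_ (h x) (∑-cong xs h)

∑-zero : (xs : List A) → ∑ xs (λ _ → 0ℤ) ≡ 0ℤ
∑-zero [] = refl
∑-zero (x ∷ xs) = trans (ℤ.+-identityˡ _) (∑-zero xs)

∑-+ : (xs : List A) (f g : A → ℤ) → ∑ xs (λ x → f x + g x) ≡ ∑ xs f + ∑ xs g
∑-+ [] f g = refl
∑-+ (x ∷ xs) f g = trans (cong (f x + g x +_) (∑-+ xs f g)) (interchange (f x) (g x) _ _)
  where
  interchange : ∀ a b c d → a + b + (c + d) ≡ a + c + (b + d)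
  interchange = solve-∀

∑-*ˡ : (a : ℤ) (xs : List A) (f : A → ℤ) → ∑ xs (λ x → a * f x) ≡ a * ∑ xs f
∑-*ˡ a [] f = sym (ℤ.*-zeroʳ a)
∑-*ˡ a (x ∷ xs) f = trans (cong (a * f x +_) (∑-*ˡ a xs f)) (sym (ℤ.*-distribˡ-+ a (f x) _))

∑-*ʳ : (a : ℤ) (xs : List A) (f : A → ℤ) → ∑ xs (λ x → f x * a) ≡ ∑ xs f * a
∑-*ʳ a xs f = trans (∑-cong xs (λ x → ℤ.*-comm (f x) a)) (trans (∑-*ˡ a xs f) (ℤ.*-comm a _))

∑-swap : (xs : List A) (ys : List B) (f : A → B → ℤ) →
  ∑ xs (λ x → ∑ ys (f x)) ≡ ∑ ys (λ y → ∑ xs (λ x → f x y))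
∑-swap [] ys f = sym (∑-zero ys)
∑-swap (x ∷ xs) ys f = trans (cong (∑ ys (f x) +_) (∑-swap xs ys f)) (sym (∑-+ ys (f x) _))

∑-map : (h : A → B) (xs : List A) (f : B → ℤ) → ∑ (map h xs) f ≡ ∑ xs (f ∘ h)
∑-map h [] f = refl
∑-map h (x ∷ xs) f = cong (f (h x) +_) (∑-map h xs f)

∑-++ : (xs ys : List A) (f : A → ℤ) → ∑ (xs ++ ys) f ≡ ∑ xs f + ∑ ys f
∑-++ [] ys f = sym (ℤ.+-identityˡ _)
∑-++ (x ∷ xs) ys f = trans (cong (f x +_) (∑-++ xs ys f)) (sym (ℤ.+-assoc (f x) _ _))

∑-concatMap : (h : A → List B) (xs : List A) (f : B → ℤ) →
  ∑ (concatMap h xs) f ≡ ∑ xs (λ x → ∑ (h x) f)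
∑-concatMap h [] f = refl
∑-concatMap h (x ∷ xs) f = trans (∑-++ (h x) _ f) (cong (∑ (h x) f +_) (∑-concatMap h xs f))

∑-filterB : (p : A → Bool) (xs : List A) (f : A → ℤ) →
  ∑ (filterB p xs) f ≡ ∑ xs (λ x → if p x then f x else 0ℤ)
∑-filterB p [] f = refl
∑-filterB p (x ∷ xs) f with p x
... | true  = cong (f x +_) (∑-filterB p xs f)
... | false = trans (∑-filterB p xs f) (sym (ℤ.+-identityˡ _))

∑-elems-suc : ∀ n (f : Fin (suc n) → ℤ) → ∑ (elems (suc n)) f ≡ f zero + ∑ (elems n) (f ∘ suc)
∑-elems-suc n f = cong (f zero +_) (∑-tabulate n suc id)
  where
  ∑-tabulate : ∀ n {m} (g : Fin m → Fin (suc _)) (h : Fin n → Fin m) →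
    ∑ (toList (tabulate (g ∘ h))) f ≡ ∑ (toList (tabulate h)) (f ∘ g)
  ∑-tabulate zero g h = refl
  ∑-tabulate (suc n) g h = cong (f (g (h zero)) +_) (∑-tabulate n g (h ∘ suc))

𝟙 : {P : Set} → Dec P → ℤ
𝟙 d = if does d then 1ℤ else 0ℤ

𝟙-yes : {P : Set} (d : Dec P) → P → 𝟙 d ≡ 1ℤ
𝟙-yes d p rewrite dec-true d p = refl

𝟙-no : {P : Set} (d : Dec P) → ¬ P → 𝟙 d ≡ 0ℤ
𝟙-no d ¬p rewrite dec-false d ¬p = refl

𝟙-⇔ : {P Q : Set} (d : Dec P) (d′ : Dec Q) → (P → Q) → (Q → P) → 𝟙 d ≡ 𝟙 d′
𝟙-⇔ (yes p) d′ f g = sym (𝟙-yes d′ (f p))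
𝟙-⇔ (no ¬p) d′ f g = sym (𝟙-no d′ (¬p ∘ g))

𝟙-*-cong : {P : Set} (d : Dec P) {a b : ℤ} → (P → a ≡ b) → 𝟙 d * a ≡ 𝟙 d * b
𝟙-*-cong (yes p) h = cong (1ℤ *_) (h p)
𝟙-*-cong (no _)  h = refl

𝟙-* : {P Q R : Set} (d : Dec P) (d₁ : Dec Q) (d₂ : Dec R) →
  (P → Q × R) → (Q → R → P) → 𝟙 d ≡ 𝟙 d₁ * 𝟙 d₂
𝟙-* d (no ¬q) d₂ f g = 𝟙-no d (¬q ∘ proj₁ ∘ f)
𝟙-* d (yes q) d₂ f g = trans (𝟙-⇔ d d₂ (proj₂ ∘ f) (g q)) (sym (ℤ.*-identityˡ _))

-- The lists enumerate functions only up to `≗`, so a bijection between them is given as a 0-1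
-- matrix `R?` with all row and column sums 1; inserting these sums and exchanging the summations
-- moves `f` to `g`.
∑-double-counting : {P : A → Set} {Q : B → Set} {R : A → B → Set} (R? : ∀ x y → Dec (R x y))
  {xs : List A} {ys : List B} {f : A → ℤ} {g : B → ℤ} → All P xs → All Q ys →
  (∀ x → P x → ∑ ys (λ y → 𝟙 (R? x y)) ≡ 1ℤ) → (∀ y → Q y → ∑ xs (λ x → 𝟙 (R? x y)) ≡ 1ℤ) →
  (∀ x y → R x y → f x ≡ g y) → ∑ xs f ≡ ∑ ys g
∑-double-counting R? {xs} {ys} {f} {g} Pxs Qys total₁ total₂ f≡g = begin
  ∑ xs f                                    ≡⟨ ∑-cong-All Pxs (λ x p → trans (sym (ℤ.*-identityˡ (f x))) (cong (_* f x) (sym (total₁ x p)))) ⟩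
  ∑ xs (λ x → ∑ ys (λ y → 𝟙 (R? x y)) * f x) ≡⟨ ∑-cong xs (λ x → sym (∑-*ʳ (f x) ys _)) ⟩
  ∑ xs (λ x → ∑ ys (λ y → 𝟙 (R? x y) * f x)) ≡⟨ ∑-cong xs (λ x → ∑-cong ys (λ y → 𝟙-*-cong (R? x y) (f≡g x y))) ⟩
  ∑ xs (λ x → ∑ ys (λ y → 𝟙 (R? x y) * g y)) ≡⟨ ∑-swap xs ys _ ⟩
  ∑ ys (λ y → ∑ xs (λ x → 𝟙 (R? x y) * g y)) ≡⟨ ∑-cong ys (λ y → ∑-*ʳ (g y) xs _) ⟩
  ∑ ys (λ y → ∑ xs (λ x → 𝟙 (R? x y)) * g y) ≡⟨ ∑-cong-All Qys (λ y p → trans (cong (_* g y) (total₂ y p)) (ℤ.*-identityˡ (g y))) ⟩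
  ∑ ys g                                    ∎
  where open ≡-Reasoning

-- Sums over functions and over permutations

∑-elems-𝟙 : ∀ n (j : Fin n) → ∑ (elems n) (λ i → 𝟙 (i ≟ j)) ≡ 1ℤ
∑-elems-𝟙 (suc n) zero = trans (∑-elems-suc n (λ i → 𝟙 (i ≟ zero))) (cong (1ℤ +_)
  (trans (∑-cong (elems n) (λ i → 𝟙-no (suc i ≟ zero) λ ())) (∑-zero (elems n))))
∑-elems-𝟙 (suc n) (suc j) = trans (∑-elems-suc n (λ i → 𝟙 (i ≟ suc j))) (trans (ℤ.+-identityˡ _)
  (trans (∑-cong (elems n) (λ i → 𝟙-⇔ (suc i ≟ suc j) (i ≟ j) suc-injective (cong suc))) (∑-elems-𝟙 n j)))

module _ (_≟ᴬ_ : DecidableEquality A) where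

  _≗?_ : (f g : Fin n → A) → Dec (f ≗ g)
  f ≗? g = all? (λ i → f i ≟ᴬ g i)

  ∑-vecs-𝟙 : (xs : List A) → (∀ y → ∑ xs (λ x → 𝟙 (x ≟ᴬ y)) ≡ 1ℤ) →
    ∀ n (g : Fin n → A) → ∑ (vecs xs n) (λ v → 𝟙 (lookup v ≗? g)) ≡ 1ℤ
  ∑-vecs-𝟙 xs total zero g = trans (ℤ.+-identityʳ _) (𝟙-yes (lookup [] ≗? g) (λ ()))
  ∑-vecs-𝟙 xs total (suc n) g = begin
    ∑ (vecs xs (suc n)) (λ v → 𝟙 (lookup v ≗? g))
      ≡⟨ ∑-concatMap _ xs _ ⟩
    ∑ xs (λ x → ∑ (map (x ∷_) (vecs xs n)) (λ v → 𝟙 (lookup v ≗? g)))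
      ≡⟨ ∑-cong xs (λ x → trans (∑-map (x ∷_) (vecs xs n) _) (trans (∑-cong (vecs xs n) (split x)) (∑-*ˡ (𝟙 (x ≟ᴬ g zero)) (vecs xs n) (λ v → 𝟙 (lookup v ≗? (g ∘ suc)))))) ⟩
    ∑ xs (λ x → 𝟙 (x ≟ᴬ g zero) * ∑ (vecs xs n) (λ v → 𝟙 (lookup v ≗? (g ∘ suc))))
      ≡⟨ ∑-cong xs (λ x → trans (cong (𝟙 (x ≟ᴬ g zero) *_) (∑-vecs-𝟙 xs total n (g ∘ suc))) (ℤ.*-identityʳ _)) ⟩
    ∑ xs (λ x → 𝟙 (x ≟ᴬ g zero))
      ≡⟨ total (g zero) ⟩
    1ℤ ∎
    where
    open ≡-Reasoning
    split : ∀ x (v : Vec A n) → 𝟙 (lookup (x ∷ v) ≗? g) ≡ 𝟙 (x ≟ᴬ g zero) * 𝟙 (lookup v ≗? (g ∘ suc))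
    split x v = 𝟙-* (lookup (x ∷ v) ≗? g) (x ≟ᴬ g zero) (lookup v ≗? (g ∘ suc))
      (λ eq → eq zero , eq ∘ suc) (λ { p eq zero → p ; p eq (suc i) → eq i })

Inj : (A → B) → Set
Inj f = ∀ {x y} → f x ≡ f y → x ≡ y

allB-true : (p : Fin n → Bool) → allB p (elems n) ≡ true → ∀ i → p i ≡ true
allB-true {n} p = go n p id
  where
  go : ∀ n {m} (p : Fin m → Bool) (h : Fin n → Fin m) → allB p (toList (tabulate h)) ≡ true → ∀ i → p (h i) ≡ true
  go (suc n) p h eq i with p (h zero) in eq₀
  go (suc n) p h eq zero    | true = eq₀
  go (suc n) p h eq (suc i) | true = go n p (h ∘ suc) eq i

allB-intro : {A : Set} {p : A → Bool} → (∀ x → p x ≡ true) → (xs : List A) → allB p xs ≡ true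
allB-intro h [] = refl
allB-intro h (x ∷ xs) rewrite h x = allB-intro h xs

isPerm⇒Inj : (σ : Fin n → Fin n) → isPerm σ ≡ true → Inj σ
isPerm⇒Inj σ eq {i} {j} σi≡σj with σ i ≟ σ j | i ≟ j | allB-true _ (allB-true _ eq i) j
... | _         | yes i≡j | _ = i≡j
... | no σi≢σj | no _    | _ = contradiction σi≡σj σi≢σj

Inj⇒isPerm : (σ : Fin n → Fin n) → Inj σ → isPerm σ ≡ true
Inj⇒isPerm σ inj = allB-intro (λ i → allB-intro (pair i) (elems _)) (elems _)
  where
  pair : ∀ i j → not ⌊ σ i ≟ σ j ⌋ ∨ ⌊ i ≟ j ⌋ ≡ true
  pair i j with σ i ≟ σ j | i ≟ j
  ... | no _   | _      = refl
  ... | yes _  | yes _  = refl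
  ... | yes eq | no i≢j = contradiction (inj eq) i≢j

filterB-All : {P : A → Set} (p : A → Bool) → (∀ x → p x ≡ true → P x) → (xs : List A) → All P (filterB p xs)
filterB-All p h [] = []
filterB-All p h (x ∷ xs) with p x in eq
... | true  = h x eq ∷ filterB-All p h xs
... | false = filterB-All p h xs

Sym-Inj : ∀ n → All Inj (Sym n)
Sym-Inj n = filterB-All {P = Inj} isPerm isPerm⇒Inj (allMaps n)

_≟ᶠ_ : (f g : Fin n → Fin n) → Dec (f ≗ g)
_≟ᶠ_ = _≗?_ _≟_

∑-Sym-𝟙 : ∀ n (g : Fin n → Fin n) → Inj g → ∑ (Sym n) (λ σ → 𝟙 (σ ≟ᶠ g)) ≡ 1ℤ
∑-Sym-𝟙 n g inj = begin
  ∑ (Sym n) (λ σ → 𝟙 (σ ≟ᶠ g))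
    ≡⟨ ∑-filterB isPerm (allMaps n) _ ⟩
  ∑ (allMaps n) (λ σ → if isPerm σ then 𝟙 (σ ≟ᶠ g) else 0ℤ)
    ≡⟨ ∑-cong (allMaps n) drop-isPerm ⟩
  ∑ (allMaps n) (λ σ → 𝟙 (σ ≟ᶠ g))
    ≡⟨ ∑-map _ (vecs (elems n) n) _ ⟩
  ∑ (vecs (elems n) n) (λ v → 𝟙 (lookup v ≟ᶠ g))
    ≡⟨ ∑-vecs-𝟙 _≟_ (elems n) (∑-elems-𝟙 n) n g ⟩
  1ℤ ∎
  where
  open ≡-Reasoning
  drop-isPerm : ∀ σ → (if isPerm σ then 𝟙 (σ ≟ᶠ g) else 0ℤ) ≡ 𝟙 (σ ≟ᶠ g)
  drop-isPerm σ with isPerm σ in eq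
  ... | true  = refl
  ... | false = sym (𝟙-no (σ ≟ᶠ g) λ σ≗g → contradiction
          (trans (sym eq) (Inj⇒isPerm σ (λ {i} {j} e → inj (trans (sym (σ≗g i)) (trans e (σ≗g j)))))) λ ())

-- If `j` were missed, punching it out would inject `Fin (suc n)` into `Fin n`.
surjective : (f : Fin n → Fin n) → Inj f → ∀ j → ∃ λ i → f i ≡ j
surjective {suc n} f inj j with any? (λ i → f i ≟ j)
... | yes p = p
... | no ¬p = contradiction (injective⇒≤ {f = λ i → punchOut (λ eq → ¬p (i , sym eq))}
                (λ eq → inj (punchOut-injective {i = j} {f _} {f _} _ _ eq))) ℕ.1+n≰n

inverse : (f : Fin n → Fin n) → Inj f →
  ∃ λ g → (∀ i → f (g i) ≡ i) × (∀ i → g (f i) ≡ i)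
inverse f inj = (λ j → proj₁ (surjective f inj j)) , (λ j → proj₂ (surjective f inj j)) ,
                λ i → inj (proj₂ (surjective f inj (f i)))

inverse-Inj : {f g : Fin n → Fin n} → (∀ i → f (g i) ≡ i) → Inj g
inverse-Inj {f = f} fg {i} {j} eq = trans (sym (fg i)) (trans (cong f eq) (fg j))

-- Permutations are identified only up to `≗`, so a sum over `Sym` can be reindexed when its summand
-- respects `≗`.
Ext : ((Fin n → Fin n) → ℤ) → Set
Ext G = ∀ {σ τ} → σ ≗ τ → G σ ≡ G τ

∑-Sym-translate : (a b : Fin n → Fin n) → Inj a → Inj b → {G : (Fin n → Fin n) → ℤ} → Ext G →
  ∑ (Sym n) (λ ζ → G (a ∘ ζ ∘ b)) ≡ ∑ (Sym n) G
∑-Sym-translate {n} a b inja injb {G} ext with inverse a inja | inverse b injb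
... | a⁻ , aa⁻ , a⁻a | b⁻ , bb⁻ , b⁻b =
  ∑-double-counting {R = λ ζ η → (a ∘ ζ ∘ b) ≗ η} (λ ζ η → (a ∘ ζ ∘ b) ≟ᶠ η) (Sym-Inj n) (Sym-Inj n)
    (λ ζ injζ → trans (∑-cong (Sym n) (λ η → 𝟙-⇔ ((a ∘ ζ ∘ b) ≟ᶠ η) (η ≟ᶠ (a ∘ ζ ∘ b))
        (λ p i → sym (p i)) (λ p i → sym (p i)))) (∑-Sym-𝟙 n _ (λ e → injb (injζ (inja e)))))
    (λ η injη → trans (∑-cong (Sym n) (λ ζ → 𝟙-⇔ ((a ∘ ζ ∘ b) ≟ᶠ η) (ζ ≟ᶠ (a⁻ ∘ η ∘ b⁻))
        (λ p i → trans (sym (a⁻a _)) (cong a⁻ (trans (cong (a ∘ ζ) (sym (bb⁻ i))) (p (b⁻ i)))))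
        (λ p i → trans (cong a (p (b i))) (trans (aa⁻ _) (cong η (b⁻b i))))))
      (∑-Sym-𝟙 n _ (λ e → inverse-Inj {f = b} {b⁻} bb⁻ (injη (inverse-Inj {f = a} {a⁻} aa⁻ e)))))
    (λ ζ η p → ext p)

-- Transpositions

transpose-left : (a b : Fin n) → transpose a b a ≡ b
transpose-left a b rewrite dec-true (a ≟ a) refl = refl

transpose-right : (a b : Fin n) → transpose a b b ≡ a
transpose-right a b with b ≟ a
... | yes b≡a = b≡a
... | no _ rewrite dec-true (b ≟ b) refl = refl

transpose-other : (a b : Fin n) {k : Fin n} → k ≢ a → k ≢ b → transpose a b k ≡ k
transpose-other a b {k} k≢a k≢b rewrite dec-false (k ≟ a) k≢a | dec-false (k ≟ b) k≢b = refl

data Transposed (a b k : Fin n) : Set where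
  left  : k ≡ a → transpose a b k ≡ b → Transposed a b k
  right : k ≡ b → transpose a b k ≡ a → Transposed a b k
  other : k ≢ a → k ≢ b → transpose a b k ≡ k → Transposed a b k

transposed : (a b k : Fin n) → Transposed a b k
transposed a b k = by-cases (k ≟ a) (k ≟ b)
  where
  by-cases : Dec (k ≡ a) → Dec (k ≡ b) → Transposed a b k
  by-cases (yes refl) _          = left refl (transpose-left a b)
  by-cases (no _)     (yes refl) = right refl (transpose-right a b)
  by-cases (no k≢a)   (no k≢b)   = other k≢a k≢b (transpose-other a b k≢a k≢b)

transpose-map : {m : ℕ} (h : Fin m → Fin n) → Inj h → ∀ a b k →
  h (transpose a b k) ≡ transpose (h a) (h b) (h k)
transpose-map h inj a b k with transposed a b k
... | left refl eq        = trans (cong h eq) (sym (transpose-left (h a) (h b)))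
... | right refl eq       = trans (cong h eq) (sym (transpose-right (h a) (h b)))
... | other k≢a k≢b eq = trans (cong h eq) (sym (transpose-other (h a) (h b) (k≢a ∘ inj) (k≢b ∘ inj)))

transpose-comm : (a b k : Fin n) → transpose a b k ≡ transpose b a k
transpose-comm a b k with transposed a b k
... | left refl eq        = trans eq (sym (transpose-right b a))
... | right refl eq       = trans eq (sym (transpose-left b a))
... | other k≢a k≢b eq = trans eq (sym (transpose-other b a k≢b k≢a))

transpose-involutive : (a b k : Fin n) → transpose a b (transpose a b k) ≡ k
transpose-involutive a b k with transposed a b k
... | left refl eq        = trans (cong (transpose a b) eq) (transpose-right a b)
... | right refl eq       = trans (cong (transpose a b) eq) (transpose-left a b)
... | other k≢a k≢b eq = trans (cong (transpose a b) eq) eq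

transpose-same : (a k : Fin n) → transpose a a k ≡ k
transpose-same a k with transposed a a k
... | left refl eq  = eq
... | right refl eq = eq
... | other _ _ eq  = eq

transpose-Inj : (a b : Fin n) → Inj (transpose a b)
transpose-Inj a b = inverse-Inj {f = transpose a b} {transpose a b} (transpose-involutive a b)

transpose-lift : (a b : Fin n) → transpose (suc a) (suc b) ≗ lift 1 (transpose a b)
transpose-lift a b zero    = refl
transpose-lift a b (suc k) = sym (transpose-map suc suc-injective a b k)

lift-Inj : {σ : Fin n → Fin n} → Inj σ → Inj (lift 1 σ)
lift-Inj inj {zero}  {zero}  eq = refl
lift-Inj inj {suc i} {suc j} eq = cong suc (inj (suc-injective eq))

∘-Inj : {σ τ : Fin n → Fin n} → Inj σ → Inj τ → Inj (σ ∘ τ)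
∘-Inj injσ injτ eq = injτ (injσ eq)

-- Deleting the point 0 from its cycle

bypass : Fin n → Fin (suc n) → Fin (suc n) → Fin n
bypass d z (suc j)       = j
bypass d (suc c) zero    = c
bypass d zero zero       = d

-- For injective σ the first argument of bypass is irrelevant.
contract : (Fin (suc n) → Fin (suc n)) → Fin n → Fin n
contract σ i = bypass i (σ zero) (σ (suc i))

contract-suc : (σ : Fin (suc n) → Fin (suc n)) {i j : Fin n} → σ (suc i) ≡ suc j → contract σ i ≡ j
contract-suc σ eq rewrite eq = refl

contract-zero : (σ : Fin (suc n) → Fin (suc n)) {i c : Fin n} → σ (suc i) ≡ zero → σ zero ≡ suc c → contract σ i ≡ c
contract-zero σ eq₁ eq₂ rewrite eq₁ | eq₂ = refl

contract-cong : {σ τ : Fin (suc n) → Fin (suc n)} → σ ≗ τ → contract σ ≗ contract τ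
contract-cong eq i = cong₂ (bypass i) (eq zero) (eq (suc i))

data Image (σ : Fin (suc n) → Fin (suc n)) (i : Fin n) : Set where
  direct : ∀ {j} → σ (suc i) ≡ suc j → contract σ i ≡ j → Image σ i
  via0   : ∀ {c} → σ (suc i) ≡ zero → σ zero ≡ suc c → contract σ i ≡ c → Image σ i

image : (σ : Fin (suc n) → Fin (suc n)) → Inj σ → ∀ i → Image σ i
image σ inj i with σ (suc i) in eq₁ | σ zero in eq₀
... | suc j | _     = direct eq₁ (contract-suc σ eq₁)
... | zero  | suc c = via0 eq₁ eq₀ (contract-zero σ eq₁ eq₀)
... | zero  | zero  = contradiction (inj (trans eq₀ (sym eq₁))) λ ()

contract-Inj : (σ : Fin (suc n) → Fin (suc n)) → Inj σ → Inj (contract σ)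
contract-Inj σ inj {i} {j} eq with image σ inj i | image σ inj j
... | direct p p′   | direct q q′   = suc-injective (inj (trans p (trans (cong suc (trans (sym p′) (trans eq q′))) (sym q))))
... | direct p p′   | via0 q₁ q₂ q′ = contradiction (inj (trans p (trans (cong suc (trans (sym p′) (trans eq q′))) (sym q₂)))) λ ()
... | via0 p₁ p₂ p′ | direct q q′   = contradiction (inj (trans q (trans (cong suc (trans (sym q′) (trans (sym eq) p′))) (sym p₂)))) λ ()
... | via0 p₁ p₂ p′ | via0 q₁ q₂ q′ = suc-injective (inj (trans p₁ (sym q₁)))

contract-∘lift : (ρ : Fin (suc n) → Fin (suc n)) → Inj ρ → (σ : Fin n → Fin n) →
  contract (ρ ∘ lift 1 σ) ≗ contract ρ ∘ σ
contract-∘lift ρ inj σ i with image ρ inj (σ i)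
... | direct p p′   = trans (contract-suc (ρ ∘ lift 1 σ) p) (sym p′)
... | via0 p₁ p₂ p′ = trans (contract-zero (ρ ∘ lift 1 σ) p₁ p₂) (sym p′)

contract-lift∘ : (ρ : Fin (suc n) → Fin (suc n)) → Inj ρ → (σ : Fin n → Fin n) →
  contract (lift 1 σ ∘ ρ) ≗ σ ∘ contract ρ
contract-lift∘ ρ inj σ i with image ρ inj i
... | direct p p′   = trans (contract-suc (lift 1 σ ∘ ρ) (cong (lift 1 σ) p)) (cong σ (sym p′))
... | via0 p₁ p₂ p′ = trans (contract-zero (lift 1 σ ∘ ρ) (cong (lift 1 σ) p₁) (cong (lift 1 σ) p₂)) (cong σ (sym p′))

contract-decompose : (ζ : Fin (suc n) → Fin (suc n)) → Inj ζ →
  ζ ≗ transpose zero (ζ zero) ∘ lift 1 (contract ζ)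
contract-decompose ζ inj zero = sym (transpose-left zero (ζ zero))
contract-decompose ζ inj (suc i) with image ζ inj i
... | direct p p′ = trans p (trans (sym (transpose-other zero (ζ zero) (λ ()) (λ eq → 0≢1+n (inj (sym (trans p eq))))))
                      (cong (transpose zero (ζ zero) ∘ suc) (sym p′)))
... | via0 p₁ p₂ p′ = trans p₁ (trans (sym (transpose-right zero (ζ zero)))
                      (cong (transpose zero (ζ zero)) (trans p₂ (cong suc (sym p′)))))

contract-insert : (y : Fin (suc n)) (σ : Fin n → Fin n) → contract (transpose zero y ∘ lift 1 σ) ≗ σ
contract-insert y σ i with transposed zero y (suc (σ i))
... | right refl eq  = contract-zero (transpose zero y ∘ lift 1 σ) eq refl
... | other _ _ eq = contract-suc (transpose zero y ∘ lift 1 σ) eq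

-- The product splices the fixed point 0 into the cycle of `suc b`, and deletion takes it out again.
contract-fix : (ζ : Fin (suc n) → Fin (suc n)) → Inj ζ → (b : Fin n) → ζ zero ≡ zero →
  contract (transpose zero (suc b) ∘ ζ) ≗ contract ζ
contract-fix ζ inj b ζ0 i with image ζ inj i
... | via0 p₁ p₂ _ = contradiction (trans (sym ζ0) p₂) λ ()
... | direct {j} p p′ with j ≟ b
...   | yes refl = trans (contract-zero (transpose zero (suc b) ∘ ζ) (trans (cong (transpose zero (suc b)) p) (transpose-right zero (suc b)))
                     (cong (transpose zero (suc b)) ζ0)) (sym p′)
...   | no j≢b = trans (contract-suc (transpose zero (suc b) ∘ ζ) (trans (cong (transpose zero (suc b)) p)
                     (transpose-other zero (suc b) (λ ()) (j≢b ∘ suc-injective)))) (sym p′)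

-- The product makes 0 a fixed point, cutting it out of its cycle exactly as `contract` does.
contract-unlink : (ζ : Fin (suc n) → Fin (suc n)) → Inj ζ → (b : Fin n) → ζ zero ≡ suc b →
  contract (transpose zero (suc b) ∘ ζ) ≗ contract ζ
contract-unlink ζ inj b ζ0 i with image ζ inj i
... | via0 p₁ p₂ p′ = trans (contract-suc (transpose zero (suc b) ∘ ζ) (cong (transpose zero (suc b)) p₁))
                        (trans (suc-injective (trans (sym ζ0) p₂)) (sym p′))
... | direct {j} p p′ = trans (contract-suc (transpose zero (suc b) ∘ ζ) (trans (cong (transpose zero (suc b)) p)
                     (transpose-other zero (suc b) (λ ()) (λ eq → contradiction (inj (trans p (trans eq (sym ζ0)))) λ ())))) (sym p′)

-- The preimage of 0 now goes to `b`, and the preimage of `suc b` now passes through 0 to `c`: after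
-- deletion `c` plays the part of 0 in the transposition.
contract-transpose : (ζ : Fin (suc n) → Fin (suc n)) → Inj ζ → (b c : Fin n) → c ≢ b → ζ zero ≡ suc c →
  contract (transpose zero (suc b) ∘ ζ) ≗ transpose b c ∘ contract ζ
contract-transpose ζ inj b c c≢b ζ0 i with image ζ inj i
... | via0 {c′} p₁ p₂ p′ = trans (contract-suc (transpose zero (suc b) ∘ ζ) (cong (transpose zero (suc b)) p₁))
      (trans (sym (transpose-right b c)) (cong (transpose b c) (trans (suc-injective (trans (sym ζ0) p₂)) (sym p′))))
... | direct {j} p p′ with j ≟ b
...   | yes refl = trans (contract-zero (transpose zero (suc b) ∘ ζ) (trans (cong (transpose zero (suc b)) p) (transpose-right zero (suc b)))
          (trans (cong (transpose zero (suc b)) ζ0) (transpose-other zero (suc b) (λ ()) (c≢b ∘ suc-injective))))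
          (trans (sym (transpose-left b c)) (cong (transpose b c) (sym p′)))
...   | no j≢b = trans (contract-suc (transpose zero (suc b) ∘ ζ) (trans (cong (transpose zero (suc b)) p)
          (transpose-other zero (suc b) (λ ()) (j≢b ∘ suc-injective))))
          (trans (sym (transpose-other b c j≢b (λ { refl → contradiction (inj (trans p (sym ζ0))) λ () }))) (cong (transpose b c) (sym p′)))

-- The maps ζ ↦ (ζ 0, `contract ζ`) and (y, σ) ↦ (0 y) ∘ `lift 1 σ` are mutually inverse. The second
-- form makes the recursive definitions below compute.
∑-Sym-suc : ∀ n {G : (Fin (suc n) → Fin (suc n)) → ℤ} → Ext G →
  ∑ (Sym (suc n)) G ≡ ∑ (elems (suc n)) (λ y → ∑ (Sym n) (λ σ → G (transpose zero y ∘ lift 1 σ)))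
∑-Sym-suc n {G} ext = sym (begin
  ∑ (elems (suc n)) (λ y → ∑ (Sym n) (λ σ → G (ins (y , σ))))
    ≡⟨ ∑-cong (elems (suc n)) (λ y → sym (∑-map (y ,_) (Sym n) (G ∘ ins))) ⟩
  ∑ (elems (suc n)) (λ y → ∑ (map (y ,_) (Sym n)) (G ∘ ins))
    ≡⟨ sym (∑-concatMap (λ y → map (y ,_) (Sym n)) (elems (suc n)) (G ∘ ins)) ⟩
  ∑ pairs (G ∘ ins)
    ≡⟨ ∑-double-counting {R = λ p ζ → ins p ≗ ζ} (λ p ζ → ins p ≟ᶠ ζ) pairs-Inj (Sym-Inj (suc n))
         (λ p inj → trans (∑-cong (Sym (suc n)) (λ ζ → 𝟙-⇔ (ins p ≟ᶠ ζ) (ζ ≟ᶠ ins p) (λ q i → sym (q i)) (λ q i → sym (q i))))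
                      (∑-Sym-𝟙 (suc n) (ins p) (∘-Inj (transpose-Inj zero (proj₁ p)) (lift-Inj inj))))
         (λ ζ inj → total ζ inj)
         (λ p ζ → ext) ⟩
  ∑ (Sym (suc n)) G ∎)
  where
  open ≡-Reasoning
  Pair : Set
  Pair = Fin (suc n) × (Fin n → Fin n)
  ins : Pair → Fin (suc n) → Fin (suc n)
  ins (y , σ) = transpose zero y ∘ lift 1 σ
  pairs : List Pair
  pairs = concatMap (λ y → map (y ,_) (Sym n)) (elems (suc n))
  All-pairs : (ys : List (Fin (suc n))) → All (Inj ∘ proj₂) (concatMap (λ y → map (y ,_) (Sym n)) ys)
  All-pairs [] = []
  All-pairs (y ∷ ys) = go (Sym-Inj n)
    where
    go : ∀ {xs} → All Inj xs → All (Inj ∘ proj₂) (map (y ,_) xs ++ concatMap (λ y → map (y ,_) (Sym n)) ys)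
    go [] = All-pairs ys
    go {x ∷ xs} (p ∷ ps) = (λ {i} {j} → p {i} {j}) ∷ go ps
  pairs-Inj : All (Inj ∘ proj₂) pairs
  pairs-Inj = All-pairs (elems (suc n))
  total : ∀ ζ → Inj ζ → ∑ pairs (λ p → 𝟙 (ins p ≟ᶠ ζ)) ≡ 1ℤ
  total ζ inj = begin
    ∑ pairs (λ p → 𝟙 (ins p ≟ᶠ ζ))
      ≡⟨ ∑-concatMap (λ y → map (y ,_) (Sym n)) (elems (suc n)) _ ⟩
    ∑ (elems (suc n)) (λ y → ∑ (map (y ,_) (Sym n)) (λ p → 𝟙 (ins p ≟ᶠ ζ)))
      ≡⟨ ∑-cong (elems (suc n)) (λ y → ∑-map (y ,_) (Sym n) _) ⟩
    ∑ (elems (suc n)) (λ y → ∑ (Sym n) (λ σ → 𝟙 (ins (y , σ) ≟ᶠ ζ)))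
      ≡⟨ ∑-cong (elems (suc n)) (λ y → ∑-cong (Sym n) (λ σ → 𝟙-* (ins (y , σ) ≟ᶠ ζ) (y ≟ ζ zero) (σ ≟ᶠ contract ζ)
           (λ q → q zero , λ i → trans (sym (contract-insert y σ i)) (contract-cong q i))
           (λ { refl q i → trans (cong (transpose zero y) (lift-cong q i)) (sym (contract-decompose ζ inj i)) }))) ⟩
    ∑ (elems (suc n)) (λ y → ∑ (Sym n) (λ σ → 𝟙 (y ≟ ζ zero) * 𝟙 (σ ≟ᶠ contract ζ)))
      ≡⟨ ∑-cong (elems (suc n)) (λ y → trans (∑-*ˡ (𝟙 (y ≟ ζ zero)) (Sym n) _)
           (trans (cong (𝟙 (y ≟ ζ zero) *_) (∑-Sym-𝟙 n (contract ζ) (contract-Inj ζ inj))) (ℤ.*-identityʳ (𝟙 (y ≟ ζ zero))))) ⟩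
    ∑ (elems (suc n)) (λ y → 𝟙 (y ≟ ζ zero))
      ≡⟨ ∑-elems-𝟙 (suc n) (ζ zero) ⟩
    1ℤ ∎
    where
    lift-cong : ∀ {σ τ : Fin n → Fin n} → σ ≗ τ → lift 1 σ ≗ lift 1 τ
    lift-cong q zero = refl
    lift-cong q (suc i) = cong suc (q i)

-- Cycle counts and signs of invariant subsets

fixes0 : Fin (suc n) → ℕ
fixes0 zero    = 1
fixes0 (suc _) = 0

-- Points are deleted in increasing order, so a cycle is counted when its largest point is left
-- alone as a fixed point.
cyc : (Fin n → Fin n) → ℕ
cyc {zero}  σ = 0
cyc {suc n} σ = fixes0 (σ zero) ℕ.+ cyc (contract σ)

cyc-cong : {σ τ : Fin n → Fin n} → σ ≗ τ → cyc σ ≡ cyc τ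
cyc-cong {zero}  eq = refl
cyc-cong {suc n} eq = cong₂ ℕ._+_ (cong fixes0 (eq zero)) (cyc-cong (contract-cong eq))

sgn : Bool → ℤ
sgn true  = -1ℤ
sgn false = 1ℤ

agree : Bool → Bool → ℤ
agree true  b = if b then 1ℤ else 0ℤ
agree false b = if b then 0ℤ else 1ℤ

agree-yes : {s t : Bool} → s ≡ t → agree s t ≡ 1ℤ
agree-yes {true}  refl = refl
agree-yes {false} refl = refl

agree-no : {s t : Bool} → s ≢ t → agree s t ≡ 0ℤ
agree-no {true}  {true}  s≢t = contradiction refl s≢t
agree-no {true}  {false} _   = refl
agree-no {false} {true}  _   = refl
agree-no {false} {false} s≢t = contradiction refl s≢t

sgn² : ∀ s x → sgn s * (sgn s * x) ≡ x
sgn² true  = solve-∀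
sgn² false = solve-∀

-- The factor that 0 contributes to the sign, given the image of 0. A fixed point completes a cycle,
-- which counts -1 inside S; otherwise 0 and its image have to lie on the same side of S.
κ : (Fin (suc n) → Bool) → Fin (suc n) → ℤ
κ S zero    = sgn (S zero)
κ S (suc c) = agree (S zero) (S (suc c))

-- ε ζ S is (-1)^(number of cycles of ζ inside S) if S is ζ-invariant, and 0 otherwise.
ε : (Fin n → Fin n) → (Fin n → Bool) → ℤ
ε {zero}  ζ S = 1ℤ
ε {suc n} ζ S = κ S (ζ zero) * ε (contract ζ) (S ∘ suc)

ε-cong : {ζ η : Fin n → Fin n} {S U : Fin n → Bool} → ζ ≗ η → S ≗ U → ε ζ S ≡ ε η U
ε-cong {zero} _ _ = refl
ε-cong {suc n} {ζ} {η} {S} {U} ζ≗η S≗U = cong₂ _*_ (trans (cong (κ S) (ζ≗η zero)) (κ-cong (η zero)))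
                                (ε-cong (contract-cong ζ≗η) (S≗U ∘ suc))
  where
  κ-cong : ∀ c → κ S c ≡ κ U c
  κ-cong zero    = cong sgn (S≗U zero)
  κ-cong (suc c) = cong₂ agree (S≗U zero) (S≗U (suc c))

ε-congˡ : {ζ η : Fin n → Fin n} (S : Fin n → Bool) → ζ ≗ η → ε ζ S ≡ ε η S
ε-congˡ S eq = ε-cong eq (λ _ → refl)

κ-no : (S : Fin (suc n) → Bool) {c : Fin n} (x : ℤ) → S zero ≢ S (suc c) → κ S (suc c) * x ≡ 0ℤ
κ-no S x ne = cong (_* x) (agree-no ne)

-- A step across the boundary of S is either seen by `κ` at 0 or survives the deletion of 0: if the
-- step leads into 0 and 0 stays on its side, the contracted step still crosses.
ε-noninvariant : (ζ : Fin n → Fin n) → Inj ζ → (S : Fin n → Bool) (i : Fin n) → S (ζ i) ≢ S i → ε ζ S ≡ 0ℤ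
ε-noninvariant {suc n} ζ inj S zero S≢ with ζ zero
... | zero  = contradiction refl S≢
... | suc c = κ-no S _ (S≢ ∘ sym)
ε-noninvariant {suc n} ζ inj S (suc i) S≢ with image ζ inj i
... | direct p p′ = trans (cong (κ S (ζ zero) *_) (ε-noninvariant (contract ζ) (contract-Inj ζ inj) (S ∘ suc) i
        (λ eq → S≢ (trans (cong S (trans p (cong suc (sym p′)))) eq)))) (ℤ.*-zeroʳ (κ S (ζ zero)))
... | via0 {c} p₁ p₂ p′ with S zero Bool.≟ S (suc c)
...   | no S0≢ = trans (cong (λ z → κ S z * ε (contract ζ) (S ∘ suc)) p₂) (κ-no S _ S0≢)
...   | yes S0≡ = trans (cong (κ S (ζ zero) *_) (ε-noninvariant (contract ζ) (contract-Inj ζ inj) (S ∘ suc) i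
        (λ eq → S≢ (trans (cong S p₁) (trans S0≡ (trans (cong (S ∘ suc) (sym p′)) eq)))))) (ℤ.*-zeroʳ (κ S (ζ zero)))

module _ where
  private
    *-left-comm : ∀ a b c → a * (b * c) ≡ b * (a * c)
    *-left-comm = solve-∀

  -- When ζ preserves S, the product merges two cycles or splits one, on the side of S that contains
  -- `a` and `b`; the number of cycles inside S changes by one exactly if that side is S.
  ε-transpose : (ζ : Fin n → Fin n) → Inj ζ → (S : Fin n → Bool) (a b : Fin n) → a ≢ b → S a ≡ S b →
    ε (transpose a b ∘ ζ) S ≡ sgn (S a) * ε ζ S
  ε-transpose₀ : (ζ : Fin (suc n) → Fin (suc n)) → Inj ζ → (S : Fin (suc n) → Bool) (b : Fin n) → S zero ≡ S (suc b) →
    ε (transpose zero (suc b) ∘ ζ) S ≡ sgn (S zero) * ε ζ S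

  ε-transpose ζ inj S zero zero a≢b _ = contradiction refl a≢b
  ε-transpose {suc n} ζ inj S zero (suc b) _ eq = ε-transpose₀ ζ inj S b eq
  ε-transpose {suc n} ζ inj S (suc a) zero _ eq =
    trans (ε-congˡ S (transpose-comm (suc a) zero ∘ ζ)) (trans (ε-transpose₀ ζ inj S a (sym eq))
      (cong (λ s → sgn s * ε ζ S) (sym eq)))
  ε-transpose {suc n} ζ inj S (suc a) (suc b) a≢b eq = begin
    κ S (transpose (suc a) (suc b) (ζ zero)) * ε (contract (transpose (suc a) (suc b) ∘ ζ)) (S ∘ suc)
      ≡⟨ cong₂ _*_ κ-same (ε-congˡ (S ∘ suc) (λ i → trans (contract-cong (transpose-lift a b ∘ ζ) i) (contract-lift∘ ζ inj (transpose a b) i))) ⟩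
    κ S (ζ zero) * ε (transpose a b ∘ contract ζ) (S ∘ suc)
      ≡⟨ cong (κ S (ζ zero) *_) (ε-transpose (contract ζ) (contract-Inj ζ inj) (S ∘ suc) a b (a≢b ∘ cong suc) eq) ⟩
    κ S (ζ zero) * (sgn (S (suc a)) * ε (contract ζ) (S ∘ suc))
      ≡⟨ *-left-comm (κ S (ζ zero)) (sgn (S (suc a))) _ ⟩
    sgn (S (suc a)) * (κ S (ζ zero) * ε (contract ζ) (S ∘ suc)) ∎
    where
    open ≡-Reasoning
    κ-same : κ S (transpose (suc a) (suc b) (ζ zero)) ≡ κ S (ζ zero)
    κ-same with transposed (suc a) (suc b) (ζ zero)
    ... | left p q = trans (cong (κ S) q) (trans (cong (agree (S zero)) (sym eq)) (cong (κ S) (sym p)))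
    ... | right p q = trans (cong (κ S) q) (trans (cong (agree (S zero)) eq) (cong (κ S) (sym p)))
    ... | other _ _ q = cong (κ S) q

  ε-transpose₀ {n} ζ inj S b eq = by-cases (ζ zero) refl
    where
    open ≡-Reasoning
    τ = transpose zero (suc b)
    E = ε (contract ζ) (S ∘ suc)
    by-cases : (z : Fin (suc n)) → ζ zero ≡ z → ε (τ ∘ ζ) S ≡ sgn (S zero) * ε ζ S
    by-cases zero ζ0 = begin
      κ S (τ (ζ zero)) * ε (contract (τ ∘ ζ)) (S ∘ suc)
        ≡⟨ cong₂ _*_ (trans (cong (κ S ∘ τ) ζ0) (agree-yes eq)) (ε-congˡ (S ∘ suc) (contract-fix ζ inj b ζ0)) ⟩
      1ℤ * E                             ≡⟨ ℤ.*-identityˡ E ⟩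
      E                                  ≡⟨ sym (sgn² (S zero) E) ⟩
      sgn (S zero) * (sgn (S zero) * E)  ≡⟨ cong (λ z → sgn (S zero) * (κ S z * E)) (sym ζ0) ⟩
      sgn (S zero) * (κ S (ζ zero) * E)  ∎
    by-cases (suc c) ζ0 with c ≟ b
    ... | yes refl = begin
      κ S (τ (ζ zero)) * ε (contract (τ ∘ ζ)) (S ∘ suc)
        ≡⟨ cong₂ _*_ (cong (κ S) (trans (cong τ ζ0) (transpose-right zero (suc b)))) (ε-congˡ (S ∘ suc) (contract-unlink ζ inj b ζ0)) ⟩
      sgn (S zero) * E                   ≡⟨ cong (sgn (S zero) *_) (sym (ℤ.*-identityˡ E)) ⟩
      sgn (S zero) * (1ℤ * E)            ≡⟨ cong (λ z → sgn (S zero) * (z * E)) (sym (trans (cong (κ S) ζ0) (agree-yes eq))) ⟩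
      sgn (S zero) * (κ S (ζ zero) * E)  ∎
    ... | no c≢b with S zero Bool.≟ S (suc c)
    ...   | no ne = begin
      κ S (τ (ζ zero)) * ε (contract (τ ∘ ζ)) (S ∘ suc)
        ≡⟨ cong (λ z → κ S z * ε (contract (τ ∘ ζ)) (S ∘ suc)) τζ0 ⟩
      κ S (suc c) * ε (contract (τ ∘ ζ)) (S ∘ suc)
        ≡⟨ κ-no S _ ne ⟩
      0ℤ  ≡⟨ sym (ℤ.*-zeroʳ (sgn (S zero))) ⟩
      sgn (S zero) * 0ℤ ≡⟨ cong (sgn (S zero) *_) (sym (trans (cong (λ z → κ S z * E) ζ0) (κ-no S E ne))) ⟩
      sgn (S zero) * (κ S (ζ zero) * E)  ∎
      where
      τζ0 : τ (ζ zero) ≡ suc c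
      τζ0 = trans (cong τ ζ0) (transpose-other zero (suc b) (λ ()) (c≢b ∘ suc-injective))
    ...   | yes S0≡ = begin
      κ S (τ (ζ zero)) * ε (contract (τ ∘ ζ)) (S ∘ suc)
        ≡⟨ cong₂ _*_ (cong (κ S) τζ0) (ε-congˡ (S ∘ suc) (contract-transpose ζ inj b c c≢b ζ0)) ⟩
      κ S (ζ zero) * ε (transpose b c ∘ contract ζ) (S ∘ suc)
        ≡⟨ cong (κ S (ζ zero) *_) (ε-transpose (contract ζ) (contract-Inj ζ inj) (S ∘ suc) b c (c≢b ∘ sym) (trans (sym eq) S0≡)) ⟩
      κ S (ζ zero) * (sgn (S (suc b)) * E)
        ≡⟨ *-left-comm (κ S (ζ zero)) (sgn (S (suc b))) E ⟩
      sgn (S (suc b)) * (κ S (ζ zero) * E)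
        ≡⟨ cong (λ s → sgn s * (κ S (ζ zero) * E)) (sym eq) ⟩
      sgn (S zero) * (κ S (ζ zero) * E)  ∎
      where
      τζ0 : τ (ζ zero) ≡ ζ zero
      τζ0 = trans (cong τ ζ0) (trans (transpose-other zero (suc b) (λ ()) (c≢b ∘ suc-injective)) (sym ζ0))

-- On the stabiliser of S the function ε - S is determined by its behaviour under
-- transpositions and by its value at the identity.
record Alternating (S : Fin n → Bool) (f : (Fin n → Fin n) → ℤ) : Set where
  field
    ext          : Ext f
    noninvariant : ∀ ζ → Inj ζ → ∀ i → S (ζ i) ≢ S i → f ζ ≡ 0ℤ
    transp       : ∀ ζ → Inj ζ → ∀ a b → a ≢ b → S a ≡ S b → f (transpose a b ∘ ζ) ≡ sgn (S a) * f ζ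

open Alternating

Alternating-lift : {S : Fin (suc n) → Bool} {f : (Fin (suc n) → Fin (suc n)) → ℤ} →
  Alternating S f → Alternating (S ∘ suc) (f ∘ lift 1)
Alternating-lift alt .ext eq = ext alt (λ { zero → refl ; (suc i) → cong suc (eq i) })
Alternating-lift alt .noninvariant ζ inj i ne = noninvariant alt (lift 1 ζ) (lift-Inj inj) (suc i) ne
Alternating-lift alt .transp ζ inj a b a≢b eq =
  trans (ext alt (λ { zero → refl ; (suc i) → sym (transpose-lift a b (suc (ζ i))) }))
        (transp alt (lift 1 ζ) (lift-Inj inj) (suc a) (suc b) (a≢b ∘ suc-injective) eq)

-- By `contract-decompose`, ζ arises from the identity by successive transpositions (0 z). If 0 and
-- its image lie on different sides of S, both functions vanish at ζ; otherwise `transp` reduces ζ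
-- to a permutation fixing 0.
Alternating-unique : {S : Fin n → Bool} {f g : (Fin n → Fin n) → ℤ} → Alternating S f → Alternating S g →
  f id ≡ g id → ∀ ζ → Inj ζ → f ζ ≡ g ζ
Alternating-unique {zero} altf altg eq ζ inj = trans (ext altf (λ ())) (trans eq (ext altg (λ ())))
Alternating-unique {suc n} {S} {f} {g} altf altg eq ζ inj = by-cases (ζ zero) refl
  where
  ζ′ = lift 1 (contract ζ)
  IH : f ζ′ ≡ g ζ′
  IH = Alternating-unique (Alternating-lift altf) (Alternating-lift altg)
         (trans (ext altf lift-id) (trans eq (ext altg (λ i → sym (lift-id i))))) (contract ζ) (contract-Inj ζ inj)
    where
    lift-id : lift 1 (id {A = Fin n}) ≗ id
    lift-id zero    = refl
    lift-id (suc i) = refl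
  ζ≗ : ∀ {z} → ζ zero ≡ z → ζ ≗ transpose zero z ∘ ζ′
  ζ≗ refl = contract-decompose ζ inj
  by-cases : ∀ z → ζ zero ≡ z → f ζ ≡ g ζ
  by-cases zero ζ0 = trans (ext altf ζ≗ζ′) (trans IH (ext altg (λ i → sym (ζ≗ζ′ i))))
    where
    ζ≗ζ′ : ζ ≗ ζ′
    ζ≗ζ′ i = trans (ζ≗ ζ0 i) (transpose-same zero (ζ′ i))
  by-cases (suc c) ζ0 with S zero Bool.≟ S (suc c)
  ... | no ne = trans (noninvariant altf ζ inj zero ne′) (sym (noninvariant altg ζ inj zero ne′))
    where
    ne′ : S (ζ zero) ≢ S zero
    ne′ q = ne (trans (sym q) (cong S ζ0))
  ... | yes S≡ = trans (ext altf (ζ≗ ζ0)) (trans (transp altf ζ′ inj′ zero (suc c) (λ ()) S≡)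
                  (trans (cong (sgn (S zero) *_) IH) (sym (trans (ext altg (ζ≗ ζ0)) (transp altg ζ′ inj′ zero (suc c) (λ ()) S≡)))))
    where
    inj′ : Inj ζ′
    inj′ = lift-Inj (contract-Inj ζ inj)

ε-Alternating : (S : Fin n → Bool) → Alternating S (λ ζ → ε ζ S)
ε-Alternating S .ext = ε-congˡ S
ε-Alternating S .noninvariant ζ inj = ε-noninvariant ζ inj S
ε-Alternating S .transp ζ inj = ε-transpose ζ inj S

ε-id : (S : Fin n → Bool) → ε id S ≡ ∏ (sgn ∘ S)
ε-id {zero} S = refl
ε-id {suc n} S = cong (sgn (S zero) *_) (ε-id (S ∘ suc))

-- The recursion for `ε` deletes points in numerical order, so invariance under relabelling cannot
-- be read off from it. Both sides are alternating for S, and at the identity both are the product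
-- of the signs of all points.
ε-conj : {g h : Fin n → Fin n} → (∀ i → g (h i) ≡ i) → (∀ i → h (g i) ≡ i) →
  (ζ : Fin n → Fin n) → Inj ζ → (S : Fin n → Bool) → ε (h ∘ ζ ∘ g) (S ∘ g) ≡ ε ζ S
ε-conj {n} {g} {h} gh hg ζ inj S = Alternating-unique alt (ε-Alternating S) at-id ζ inj
  where
  injh : Inj h
  injh = inverse-Inj {f = g} gh
  injg : Inj g
  injg = inverse-Inj {f = h} hg
  alt : Alternating S (λ ζ → ε (h ∘ ζ ∘ g) (S ∘ g))
  alt .ext eq = ε-congˡ (S ∘ g) (λ i → cong h (eq (g i)))
  alt .noninvariant ζ inj i ne = ε-noninvariant (h ∘ ζ ∘ g) (λ q → injg (inj (injh q))) (S ∘ g) (h i)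
    (λ q → ne (trans (cong (S ∘ ζ) (sym (gh i))) (trans (cong S (sym (gh _))) (trans q (cong S (gh i))))))
  alt .transp ζ inj a b a≢b eq = trans (ε-congˡ (S ∘ g) (λ i → transpose-map h injh a b (ζ (g i))))
    (trans (ε-transpose (h ∘ ζ ∘ g) (λ q → injg (inj (injh q))) (S ∘ g) (h a) (h b) (a≢b ∘ injh)
             (trans (cong S (gh a)) (trans eq (cong S (sym (gh b))))))
           (cong (λ i → sgn (S i) * ε (h ∘ ζ ∘ g) (S ∘ g)) (gh a)))
  at-id : ε (h ∘ g) (S ∘ g) ≡ ε id S
  at-id = trans (ε-congˡ (S ∘ g) hg) (trans (ε-id (S ∘ g))
    (trans (sym (∏-permute (sgn ∘ S) (permutation g h gh hg))) (sym (ε-id S))))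

-- Sums over subsets

subsets : ∀ n → List (Vec Bool n)
subsets = vecs (true ∷ false ∷ [])

∑-subsets-suc : ∀ n (G : Vec Bool (suc n) → ℤ) →
  ∑ (subsets (suc n)) G ≡ ∑ (subsets n) (G ∘ (true ∷_)) + ∑ (subsets n) (G ∘ (false ∷_))
∑-subsets-suc n G = trans (∑-concatMap (λ b → map (b ∷_) (subsets n)) (true ∷ false ∷ []) G)
  (cong₂ _+_ (∑-map (true ∷_) (subsets n) G) (trans (ℤ.+-identityʳ _) (∑-map (false ∷_) (subsets n) G)))

∑-subsets-𝟙 : (U : Fin n → Bool) → ∑ (subsets n) (λ v → 𝟙 (_≗?_ Bool._≟_ (lookup v) U)) ≡ 1ℤ
∑-subsets-𝟙 {n} U = ∑-vecs-𝟙 Bool._≟_ (true ∷ false ∷ []) (λ { true → refl ; false → refl }) n U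

∑-subsets-permute : {g h : Fin n → Fin n} → (∀ i → g (h i) ≡ i) → (∀ i → h (g i) ≡ i) →
  {G : (Fin n → Bool) → ℤ} → (∀ {S U} → S ≗ U → G S ≡ G U) →
  ∑ (subsets n) (λ v → G (lookup v ∘ g)) ≡ ∑ (subsets n) (λ v → G (lookup v))
∑-subsets-permute {n} {g} {h} gh hg {G} ext =
  ∑-double-counting {P = λ _ → ⊤} {Q = λ _ → ⊤} {R = λ u v → lookup u ∘ g ≗ lookup v} (λ u v → (lookup u ∘ g) ≟ˢ lookup v)
    (All.universal (λ _ → tt) (subsets n)) (All.universal (λ _ → tt) (subsets n))
    (λ u _ → trans (∑-cong (subsets n) (λ v → 𝟙-⇔ ((lookup u ∘ g) ≟ˢ lookup v) (lookup v ≟ˢ (lookup u ∘ g))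
        (λ p i → sym (p i)) (λ p i → sym (p i)))) (∑-subsets-𝟙 (lookup u ∘ g)))
    (λ v _ → trans (∑-cong (subsets n) (λ u → 𝟙-⇔ ((lookup u ∘ g) ≟ˢ lookup v) (lookup u ≟ˢ (lookup v ∘ h))
        (λ p i → trans (cong (lookup u) (sym (gh i))) (p (h i)))
        (λ p i → trans (p (g i)) (cong (lookup v) (hg i))))) (∑-subsets-𝟙 (lookup v ∘ h)))
    (λ u v → ext)
  where
  _≟ˢ_ : (S U : Fin n → Bool) → Dec (S ≗ U)
  _≟ˢ_ = _≗?_ Bool._≟_

-- The square of `ε ζ` is the indicator of the invariant sets, which are the unions of cycles. This
-- transfers conjugation invariance from `ε` to `cyc`.
∑ε² : (ζ : Fin n → Fin n) → ∑ (subsets n) (λ v → ε ζ (lookup v) * ε ζ (lookup v)) ≡ pos (2 ℕ.^ cyc ζ)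
∑ε² {zero} ζ = refl
∑ε² {suc n} ζ = trans (∑-subsets-suc n _) (by-cases (ζ zero))
  where
  open ≡-Reasoning
  E : Vec Bool n → ℤ
  E v = ε (contract ζ) (lookup v)
  by-cases : ∀ z →
    ∑ (subsets n) (λ v → κ (lookup (true ∷ v)) z * E v * (κ (lookup (true ∷ v)) z * E v)) +
    ∑ (subsets n) (λ v → κ (lookup (false ∷ v)) z * E v * (κ (lookup (false ∷ v)) z * E v))
    ≡ pos (2 ℕ.^ (fixes0 z ℕ.+ cyc (contract ζ)))
  by-cases zero = begin
    ∑ (subsets n) (λ v → -1ℤ * E v * (-1ℤ * E v)) + ∑ (subsets n) (λ v → 1ℤ * E v * (1ℤ * E v))
      ≡⟨ cong₂ _+_ (trans (∑-cong (subsets n) (λ v → neg-sq (E v))) (∑ε² (contract ζ)))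
                   (trans (∑-cong (subsets n) (λ v → one-sq (E v))) (∑ε² (contract ζ))) ⟩
    pos (2 ℕ.^ cyc (contract ζ)) + pos (2 ℕ.^ cyc (contract ζ))
      ≡⟨ cong (λ x → pos (2 ℕ.^ cyc (contract ζ) ℕ.+ x)) (sym (ℕ.+-identityʳ _)) ⟩
    pos (2 ℕ.^ suc (cyc (contract ζ))) ∎
    where
    neg-sq : ∀ x → -1ℤ * x * (-1ℤ * x) ≡ x * x
    neg-sq = solve-∀
    one-sq : ∀ x → 1ℤ * x * (1ℤ * x) ≡ x * x
    one-sq = solve-∀
  by-cases (suc c) = trans (sym (∑-+ (subsets n) _ _)) (trans (∑-cong (subsets n) (λ v → pick (lookup v c) (E v))) (∑ε² (contract ζ)))
    where
    pick₁ : ∀ x → 1ℤ * x * (1ℤ * x) + 0ℤ * x * (0ℤ * x) ≡ x * x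
    pick₁ = solve-∀
    pick₂ : ∀ x → 0ℤ * x * (0ℤ * x) + 1ℤ * x * (1ℤ * x) ≡ x * x
    pick₂ = solve-∀
    pick : ∀ b x → agree true b * x * (agree true b * x) + agree false b * x * (agree false b * x) ≡ x * x
    pick true  = pick₁
    pick false = pick₂

2^-injective : ∀ a b → 2 ℕ.^ a ≡ 2 ℕ.^ b → a ≡ b
2^-injective a b eq with ℕ.<-cmp a b
... | tri≈ _ a≡b _ = a≡b
... | tri< a<b _ _ = contradiction eq (ℕ.<⇒≢ (ℕ.^-monoʳ-< 2 (ℕ.s≤s (ℕ.s≤s ℕ.z≤n)) a<b))
... | tri> _ _ b<a = contradiction (sym eq) (ℕ.<⇒≢ (ℕ.^-monoʳ-< 2 (ℕ.s≤s (ℕ.s≤s ℕ.z≤n)) b<a))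

cyc-conj : {g h : Fin n → Fin n} → (∀ i → g (h i) ≡ i) → (∀ i → h (g i) ≡ i) →
  (ζ : Fin n → Fin n) → Inj ζ → cyc (h ∘ ζ ∘ g) ≡ cyc ζ
cyc-conj {n} {g} {h} gh hg ζ inj = 2^-injective _ _ (ℤ.+-injective (begin
  pos (2 ℕ.^ cyc (h ∘ ζ ∘ g))
    ≡⟨ sym (∑ε² (h ∘ ζ ∘ g)) ⟩
  ∑ (subsets n) (λ v → sq (h ∘ ζ ∘ g) (lookup v))
    ≡⟨ sym (∑-subsets-permute gh hg (λ eq → cong₂ _*_ (ε-cong (λ _ → refl) eq) (ε-cong (λ _ → refl) eq))) ⟩
  ∑ (subsets n) (λ v → sq (h ∘ ζ ∘ g) (lookup v ∘ g))
    ≡⟨ ∑-cong (subsets n) (λ v → cong₂ _*_ (ε-conj gh hg ζ inj (lookup v)) (ε-conj gh hg ζ inj (lookup v))) ⟩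
  ∑ (subsets n) (λ v → sq ζ (lookup v))
    ≡⟨ ∑ε² ζ ⟩
  pos (2 ℕ.^ cyc ζ) ∎))
  where
  open ≡-Reasoning
  sq : (Fin n → Fin n) → (Fin n → Bool) → ℤ
  sq ζ S = ε ζ S * ε ζ S

cyc-comm : (π ζ : Fin n → Fin n) → Inj π → Inj ζ → cyc (π ∘ ζ) ≡ cyc (ζ ∘ π)
cyc-comm π ζ injπ injζ with inverse π injπ
... | π⁻ , ππ⁻ , π⁻π = trans (sym (cyc-conj {g = π} {π⁻} ππ⁻ π⁻π (π ∘ ζ) (∘-Inj injπ injζ))) (cyc-cong (λ i → π⁻π (ζ (π i))))

-- Inclusion-exclusion over the unions of cycles that avoid a given point

cyc-positive : (ζ : Fin (suc n) → Fin (suc n)) → ∃ λ m → cyc ζ ≡ suc m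
cyc-positive {zero} ζ with ζ zero
... | zero = 0 , refl
cyc-positive {suc n} ζ with cyc-positive (contract ζ)
... | m , eq = fixes0 (ζ zero) ℕ.+ m , trans (cong (fixes0 (ζ zero) ℕ.+_) eq) (ℕ.+-suc _ m)

split-agree : ∀ b x → agree true b * x + agree false b * x ≡ x
split-agree true = pick
  where
  pick : ∀ x → 1ℤ * x + 0ℤ * x ≡ x
  pick = solve-∀
split-agree false = pick
  where
  pick : ∀ x → 0ℤ * x + 1ℤ * x ≡ x
  pick = solve-∀

neg-cancel : ∀ a x → a * (-1ℤ * x) + a * (1ℤ * x) ≡ 0ℤ
neg-cancel = solve-∀

-- Each cycle may be in or out of S and contributes 1 - 1; there is at least one cycle.
∑ε-zero : (ζ : Fin (suc n) → Fin (suc n)) → ∑ (subsets (suc n)) (λ v → ε ζ (lookup v)) ≡ 0ℤ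
∑ε-zero {n} ζ = trans (∑-subsets-suc n _) (trans (sym (∑-+ (subsets n) _ _)) (by-cases (ζ zero)))
  where
  E : Vec Bool n → ℤ
  E v = ε (contract ζ) (lookup v)
  neg : ∀ x → -1ℤ * x + 1ℤ * x ≡ 0ℤ
  neg = solve-∀
  by-cases : ∀ z → ∑ (subsets n) (λ v → κ (lookup (true ∷ v)) z * E v + κ (lookup (false ∷ v)) z * E v) ≡ 0ℤ
  by-cases zero = trans (∑-cong (subsets n) (λ v → neg (E v))) (∑-zero (subsets n))
  by-cases (suc c) = trans (∑-cong (subsets n) (λ v → split-agree (lookup v c) (E v))) (∑E c)
    where
    ∑E : Fin n → ∑ (subsets n) E ≡ 0ℤ
    ∑E zero    = ∑ε-zero (contract ζ)
    ∑E (suc _) = ∑ε-zero (contract ζ)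

-- The cycle of `x` is forced out of S and contributes 1, every other cycle contributes 1 - 1. When
-- the moved point 0 is `x` itself, its image takes over as the point to be avoided.
∑ε-avoiding : (ζ : Fin n → Fin n) (x : Fin n) →
  ∑ (subsets n) (λ v → agree false (lookup v x) * ε ζ (lookup v)) ≡ 𝟙 (cyc ζ ℕ.≟ 1)
∑ε-avoiding {suc n} ζ x = trans (∑-subsets-suc n _) (trans (sym (∑-+ (subsets n) _ _)) (by-cases x (ζ zero)))
  where
  E : Vec Bool n → ℤ
  E v = ε (contract ζ) (lookup v)
  not-one : Fin n → 𝟙 (suc (cyc (contract ζ)) ℕ.≟ 1) ≡ 0ℤ
  not-one i = 𝟙-no (suc (cyc (contract ζ)) ℕ.≟ 1) (λ eq → positive i (contract ζ) (ℕ.suc-injective eq))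
    where
    positive : ∀ {n} → Fin n → (η : Fin n → Fin n) → cyc η ≢ 0
    positive {suc n} _ η eq with cyc-positive η
    ... | m , eq′ = contradiction (trans (sym eq) eq′) λ ()
  by-cases : ∀ x z → ∑ (subsets n) (λ v →
    agree false (lookup (true ∷ v) x) * (κ (lookup (true ∷ v)) z * E v) +
    agree false (lookup (false ∷ v) x) * (κ (lookup (false ∷ v)) z * E v)) ≡ 𝟙 (fixes0 z ℕ.+ cyc (contract ζ) ℕ.≟ 1)
  by-cases zero zero = trans (∑-cong (subsets n) (λ v → drop (E v))) (last-point n (contract ζ))
    where
    drop : ∀ x → 0ℤ * (-1ℤ * x) + 1ℤ * (1ℤ * x) ≡ x
    drop = solve-∀
    last-point : ∀ n (η : Fin n → Fin n) → ∑ (subsets n) (λ v → ε η (lookup v)) ≡ 𝟙 (suc (cyc η) ℕ.≟ 1)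
    last-point zero η = refl
    last-point (suc n) η with cyc-positive η
    ... | m , eq = trans (∑ε-zero η) (sym (𝟙-no (suc (cyc η) ℕ.≟ 1) (λ q → contradiction (trans (sym (ℕ.suc-injective q)) eq) λ ())))
  by-cases zero (suc c) = trans (∑-cong (subsets n) (λ v → drop (agree true (lookup v c)) (agree false (lookup v c)) (E v)))
                            (∑ε-avoiding (contract ζ) c)
    where
    drop : ∀ a b x → 0ℤ * (a * x) + 1ℤ * (b * x) ≡ b * x
    drop = solve-∀
  by-cases (suc x) zero = trans (∑-cong (subsets n) (λ v → neg-cancel (agree false (lookup v x)) (E v)))
                            (trans (∑-zero (subsets n)) (sym (not-one x)))
  by-cases (suc x) (suc c) = trans (∑-cong (subsets n) (λ v → trans
      (sym (ℤ.*-distribˡ-+ (agree false (lookup v x)) (agree true (lookup v c) * E v) (agree false (lookup v c) * E v)))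
      (cong (agree false (lookup v x) *_) (split-agree (lookup v c) (E v)))))
    (∑ε-avoiding (contract ζ) x)

-- Auxiliary sums, transpositions on the right, rising products

∑-elems-const : ∀ n a → ∑ (elems n) (λ _ → a) ≡ pos n * a
∑-elems-const zero a = sym (ℤ.*-zeroˡ a)
∑-elems-const (suc n) a = trans (∑-elems-suc n (λ _ → a)) (trans (cong (a +_) (∑-elems-const n a)) (sym (ℤ.suc-* (pos n) a)))

∑-elems-except : (p : Fin n) {f g : Fin n → ℤ} {a : ℤ} → f p ≡ a → (∀ y → y ≢ p → f y ≡ g y) →
  ∑ (elems n) f ≡ ∑ (elems n) g + (a - g p)
∑-elems-except {n} p {f} {g} {a} fp f≡g = begin
  ∑ (elems n) f
    ≡⟨ ∑-cong (elems n) (λ y → by-cases y (y ≟ p)) ⟩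
  ∑ (elems n) (λ y → g y + 𝟙 (y ≟ p) * (a - g p))
    ≡⟨ ∑-+ (elems n) g (λ y → 𝟙 (y ≟ p) * (a - g p)) ⟩
  ∑ (elems n) g + ∑ (elems n) (λ y → 𝟙 (y ≟ p) * (a - g p))
    ≡⟨ cong (∑ (elems n) g +_) (trans (∑-*ʳ (a - g p) (elems n) (λ y → 𝟙 (y ≟ p)))
         (trans (cong (_* (a - g p)) (∑-elems-𝟙 n p)) (ℤ.*-identityˡ (a - g p)))) ⟩
  ∑ (elems n) g + (a - g p) ∎
  where
  open ≡-Reasoning
  shift : ∀ a b → a ≡ b + 1ℤ * (a - b)
  shift = solve-∀
  keep : ∀ b c → b ≡ b + 0ℤ * c
  keep = solve-∀
  by-cases : ∀ y (d : Dec (y ≡ p)) → f y ≡ g y + 𝟙 d * (a - g p)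
  by-cases y (yes refl) = trans fp (shift a (g y))
  by-cases y (no y≢p)   = trans (f≡g y y≢p) (keep (g y) (a - g p))

-- If ζ keeps `a` and `b` on their side of S, this is left multiplication by (ζ a ζ b); otherwise
-- neither ζ nor the product preserves S and both signs are 0.
ε-transposeʳ : (ζ : Fin n → Fin n) → Inj ζ → (S : Fin n → Bool) (a b : Fin n) → a ≢ b → S a ≡ S b →
  ε (ζ ∘ transpose a b) S ≡ sgn (S a) * ε ζ S
ε-transposeʳ ζ inj S a b a≢b Sa≡Sb with S (ζ a) Bool.≟ S a | S (ζ b) Bool.≟ S b
... | yes p | yes q = trans (ε-congˡ S (transpose-map ζ inj a b))
      (trans (ε-transpose ζ inj S (ζ a) (ζ b) (a≢b ∘ inj) (trans p (trans Sa≡Sb (sym q))))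
             (cong (λ s → sgn s * ε ζ S) p))
... | no p | _ = trans (ε-noninvariant (ζ ∘ transpose a b) (∘-Inj inj (transpose-Inj a b)) S b
        (λ eq → p (trans (cong (S ∘ ζ) (sym (transpose-right a b))) (trans eq (sym Sa≡Sb)))))
      (sym (trans (cong (sgn (S a) *_) (ε-noninvariant ζ inj S a p)) (ℤ.*-zeroʳ (sgn (S a)))))
... | yes _ | no p = trans (ε-noninvariant (ζ ∘ transpose a b) (∘-Inj inj (transpose-Inj a b)) S a
        (λ eq → p (trans (cong (S ∘ ζ) (sym (transpose-left a b))) (trans eq Sa≡Sb))))
      (sym (trans (cong (sgn (S a) *_) (ε-noninvariant ζ inj S b p)) (ℤ.*-zeroʳ (sgn (S a)))))

ε-∅ : (ζ : Fin n → Fin n) → ε ζ (λ _ → false) ≡ 1ℤ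
ε-∅ {zero} ζ = refl
ε-∅ {suc n} ζ = cong₂ _*_ (κ-∅ (ζ zero)) (ε-∅ (contract ζ))
  where
  κ-∅ : ∀ z → κ {n} (λ _ → false) z ≡ 1ℤ
  κ-∅ zero    = refl
  κ-∅ (suc _) = refl

rising : ℤ → ℕ → ℤ
rising a zero    = 1ℤ
rising a (suc m) = a * rising (a + 1ℤ) m

rising-suc : ∀ a m → rising a (suc m) ≡ rising a m * (a + pos m)
rising-suc a zero = base a
  where
  base : ∀ a → a * 1ℤ ≡ 1ℤ * (a + 0ℤ)
  base = solve-∀
rising-suc a (suc m) = trans (cong (a *_) (rising-suc (a + 1ℤ) m)) (step a (rising (a + 1ℤ) m) (pos m))
  where
  step : ∀ a x m → a * (x * (a + 1ℤ + m)) ≡ a * x * (a + (1ℤ + m))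
  step = solve-∀

x≡-x⇒x≡0 : ∀ x → x ≡ -1ℤ * x → x ≡ 0ℤ
x≡-x⇒x≡0 x eq with ℤ.i*j≡0⇒i≡0∨j≡0 (pos 2) {x} (trans (double x) (trans (cong (x +_) eq) (cancel x)))
  where
  double : ∀ x → pos 2 * x ≡ x + x
  double = solve-∀
  cancel : ∀ x → x + -1ℤ * x ≡ 0ℤ
  cancel = solve-∀
... | inj₂ eq₀ = eq₀

full : Fin n → Bool
full _ = true

-- The sums X: recurrence, symmetries, values at the empty and the full set

module Evaluation (q : ℤ) where

  X : (Fin n → Fin n) → (Fin n → Bool) → ℤ
  X {n} π S = ∑ (Sym n) (λ ζ → ε ζ S * q ^ cyc (π ∘ ζ))

  X-summand-Ext : (π : Fin n → Fin n) (S : Fin n → Bool) → Ext (λ ζ → ε ζ S * q ^ cyc (π ∘ ζ))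
  X-summand-Ext π S eq = cong₂ (λ x k → x * q ^ k) (ε-congˡ S eq) (cyc-cong (λ i → cong π (eq i)))

  X-cong : {π ρ : Fin n → Fin n} {S U : Fin n → Bool} → π ≗ ρ → S ≗ U → X π S ≡ X ρ U
  X-cong {n} π≗ρ S≗U = ∑-cong (Sym n) (λ ζ → cong₂ (λ x k → x * q ^ k) (ε-cong (λ _ → refl) S≗U) (cyc-cong (λ i → π≗ρ (ζ i))))

  -- For ζ = (0 y) ∘ `lift 1 σ` the point 0 splits off: it contributes `κ S y` to the sign, and π ∘
  -- ζ fixes 0 exactly when π y = 0. The contraction of π ∘ (0 y) takes the place of π.
  X-suc : (π : Fin (suc n) → Fin (suc n)) → Inj π → (S : Fin (suc n) → Bool) →
    X π S ≡ ∑ (elems (suc n)) (λ y → κ S y * q ^ fixes0 (π y) * X (contract (π ∘ transpose zero y)) (S ∘ suc))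
  X-suc {n} π inj S = trans (∑-Sym-suc n (X-summand-Ext π S)) (∑-cong (elems (suc n)) (λ y →
    trans (∑-cong (Sym n) (step y))
          (∑-*ˡ (κ S y * q ^ fixes0 (π y)) (Sym n) (λ σ → ε σ (S ∘ suc) * q ^ cyc (contract (π ∘ transpose zero y) ∘ σ)))))
    where
    open ≡-Reasoning
    rearrange : ∀ a b c d → a * b * (c * d) ≡ a * c * (b * d)
    rearrange = solve-∀
    step : ∀ y (σ : Fin n → Fin n) → ε (transpose zero y ∘ lift 1 σ) S * q ^ cyc (π ∘ transpose zero y ∘ lift 1 σ)
      ≡ κ S y * q ^ fixes0 (π y) * (ε σ (S ∘ suc) * q ^ cyc (contract (π ∘ transpose zero y) ∘ σ))
    step y σ = begin
      κ S y * ε (contract (transpose zero y ∘ lift 1 σ)) (S ∘ suc) * q ^ (fixes0 (π y) ℕ.+ cyc (contract (π ∘ transpose zero y ∘ lift 1 σ)))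
        ≡⟨ cong₂ (λ x k → κ S y * x * q ^ (fixes0 (π y) ℕ.+ k)) (ε-congˡ (S ∘ suc) (contract-insert y σ))
             (cyc-cong (contract-∘lift (π ∘ transpose zero y) (∘-Inj inj (transpose-Inj zero y)) σ)) ⟩
      κ S y * ε σ (S ∘ suc) * q ^ (fixes0 (π y) ℕ.+ cyc (contract (π ∘ transpose zero y) ∘ σ))
        ≡⟨ cong (κ S y * ε σ (S ∘ suc) *_) (ℤ.^-distribˡ-+-* q (fixes0 (π y)) _) ⟩
      κ S y * ε σ (S ∘ suc) * (q ^ fixes0 (π y) * q ^ cyc (contract (π ∘ transpose zero y) ∘ σ))
        ≡⟨ rearrange (κ S y) (ε σ (S ∘ suc)) (q ^ fixes0 (π y)) _ ⟩
      κ S y * q ^ fixes0 (π y) * (ε σ (S ∘ suc) * q ^ cyc (contract (π ∘ transpose zero y) ∘ σ)) ∎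

  Φ : (Fin n → Fin n) → ℤ
  Φ {n} π = ∑ (Sym n) (λ ζ → 𝟙 (cyc ζ ℕ.≟ 1) * q ^ cyc (π ∘ ζ))

  Φ-expand : (π : Fin (suc n) → Fin (suc n)) → Φ π ≡ ∑ (subsets n) (λ v → X π (lookup (false ∷ v)))
  Φ-expand {n} π = begin
    Φ π
      ≡⟨ ∑-cong (Sym (suc n)) (λ ζ → trans (cong (_* w ζ) (sym (∑ε-avoiding ζ zero)))
           (trans (sym (∑-*ʳ (w ζ) (subsets (suc n)) (λ v → agree false (lookup v zero) * ε ζ (lookup v))))
             (∑-cong (subsets (suc n)) (λ v → ℤ.*-assoc (agree false (lookup v zero)) (ε ζ (lookup v)) (w ζ))))) ⟩
    ∑ (Sym (suc n)) (λ ζ → ∑ (subsets (suc n)) (λ v → agree false (lookup v zero) * (ε ζ (lookup v) * w ζ)))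
      ≡⟨ ∑-swap (Sym (suc n)) (subsets (suc n)) _ ⟩
    ∑ (subsets (suc n)) (λ v → ∑ (Sym (suc n)) (λ ζ → agree false (lookup v zero) * (ε ζ (lookup v) * w ζ)))
      ≡⟨ ∑-cong (subsets (suc n)) (λ v → ∑-*ˡ (agree false (lookup v zero)) (Sym (suc n)) (λ ζ → ε ζ (lookup v) * w ζ)) ⟩
    ∑ (subsets (suc n)) (λ v → agree false (lookup v zero) * X π (lookup v))
      ≡⟨ ∑-subsets-suc n (λ v → agree false (lookup v zero) * X π (lookup v)) ⟩
    ∑ (subsets n) (λ v → 0ℤ * X π (lookup (true ∷ v))) + ∑ (subsets n) (λ v → 1ℤ * X π (lookup (false ∷ v)))
      ≡⟨ cong₂ _+_ (trans (∑-cong (subsets n) (λ v → ℤ.*-zeroˡ (X π (lookup (true ∷ v))))) (∑-zero (subsets n)))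
                   (∑-cong (subsets n) (λ v → ℤ.*-identityˡ (X π (lookup (false ∷ v))))) ⟩
    0ℤ + ∑ (subsets n) (λ v → X π (lookup (false ∷ v)))
      ≡⟨ ℤ.+-identityˡ _ ⟩
    ∑ (subsets n) (λ v → X π (lookup (false ∷ v))) ∎
    where
    open ≡-Reasoning
    w : (Fin (suc n) → Fin (suc n)) → ℤ
    w ζ = q ^ cyc (π ∘ ζ)

  -- ζ ↦ (a b) ∘ ζ ∘ (π a  π b) conjugates π ∘ ζ and changes the sign of ε ζ S.
  X-two-exits : (π : Fin n → Fin n) → Inj π → (S : Fin n → Bool) (a b : Fin n) → a ≢ b →
    S a ≡ true → S b ≡ true → S (π a) ≡ false → S (π b) ≡ false → X π S ≡ 0ℤ
  X-two-exits {n} π inj S a b a≢b Sa Sb Sπa Sπb = x≡-x⇒x≡0 _ (begin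
    X π S
      ≡⟨ sym (∑-Sym-translate t t′ (transpose-Inj a b) (transpose-Inj (π a) (π b)) (X-summand-Ext π S)) ⟩
    ∑ (Sym n) (λ ζ → ε (t ∘ ζ ∘ t′) S * q ^ cyc (π ∘ t ∘ ζ ∘ t′))
      ≡⟨ ∑-cong-All (Sym-Inj n) (λ ζ injζ → trans (cong₂ (λ x k → x * q ^ k) (flip ζ injζ) (same ζ injζ)) (ℤ.*-assoc -1ℤ (ε ζ S) _)) ⟩
    ∑ (Sym n) (λ ζ → -1ℤ * (ε ζ S * q ^ cyc (π ∘ ζ)))
      ≡⟨ ∑-*ˡ -1ℤ (Sym n) (λ ζ → ε ζ S * q ^ cyc (π ∘ ζ)) ⟩
    -1ℤ * X π S ∎)
    where
    open ≡-Reasoning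
    t  = transpose a b
    t′ = transpose (π a) (π b)
    flip : ∀ ζ → Inj ζ → ε (t ∘ ζ ∘ t′) S ≡ -1ℤ * ε ζ S
    flip ζ injζ = trans (ε-transpose (ζ ∘ t′) (∘-Inj injζ (transpose-Inj (π a) (π b))) S a b a≢b (trans Sa (sym Sb)))
      (cong₂ (λ s x → sgn s * x) Sa (trans (ε-transposeʳ ζ injζ S (π a) (π b) (a≢b ∘ inj) (trans Sπa (sym Sπb)))
        (trans (cong (λ s → sgn s * ε ζ S) Sπa) (ℤ.*-identityˡ (ε ζ S)))))
    same : ∀ ζ → Inj ζ → cyc (π ∘ t ∘ ζ ∘ t′) ≡ cyc (π ∘ ζ)
    same ζ injζ = trans (cyc-cong (λ i → transpose-map π inj a b (ζ (t′ i))))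
      (cyc-conj {g = t′} {t′} (transpose-involutive (π a) (π b)) (transpose-involutive (π a) (π b)) (π ∘ ζ) (∘-Inj inj injζ))

  -- Substituting π⁻¹ ∘ ζ ∘ π for ζ turns π ∘ ζ into ζ ∘ π, which has the same number of cycles.
  X-rotate : (π : Fin n → Fin n) → Inj π → (S : Fin n → Bool) → X π (S ∘ π) ≡ X π S
  X-rotate {n} π inj S with inverse π inj
  ... | π⁻ , ππ⁻ , π⁻π = trans
    (sym (∑-Sym-translate π⁻ π (inverse-Inj {f = π} {π⁻} ππ⁻) inj (X-summand-Ext π (S ∘ π))))
    (∑-cong-All (Sym-Inj n) (λ ζ injζ → cong₂ (λ x k → x * q ^ k) (ε-conj ππ⁻ π⁻π ζ injζ S)
      (trans (cyc-cong (λ i → ππ⁻ (ζ (π i)))) (cyc-comm ζ π injζ inj))))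

  -- Among the n + 1 choices of y in the recurrence, the one with π y = 0 has weight q and the
  -- others weight 1, which gives the factor q + n.
  X-∅ : (π : Fin n → Fin n) → Inj π → X π (λ _ → false) ≡ rising q n
  X-∅ {zero} π inj = refl
  X-∅ {suc n} π inj with surjective π inj zero
  ... | p , πp = begin
    X π (λ _ → false)
      ≡⟨ X-suc π inj (λ _ → false) ⟩
    ∑ (elems (suc n)) (λ y → κ (λ _ → false) y * q ^ fixes0 (π y) * X (contract (π ∘ transpose zero y)) (λ _ → false))
      ≡⟨ ∑-cong (elems (suc n)) (λ y → cong₂ _*_ (trans (cong (_* q ^ fixes0 (π y)) (κ-∅ y)) (ℤ.*-identityˡ (q ^ fixes0 (π y))))
           (X-∅ (contract (π ∘ transpose zero y)) (contract-Inj (π ∘ transpose zero y) (∘-Inj inj (transpose-Inj zero y))))) ⟩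
    ∑ (elems (suc n)) (λ y → q ^ fixes0 (π y) * rising q n)
      ≡⟨ ∑-*ʳ (rising q n) (elems (suc n)) (λ y → q ^ fixes0 (π y)) ⟩
    ∑ (elems (suc n)) (λ y → q ^ fixes0 (π y)) * rising q n
      ≡⟨ cong (_* rising q n) (∑-elems-except p {g = λ _ → 1ℤ} (trans (cong (λ z → q ^ fixes0 z) πp) (ℤ.^-identityʳ q)) other-points) ⟩
    (∑ (elems (suc n)) (λ _ → 1ℤ) + (q - 1ℤ)) * rising q n
      ≡⟨ cong (λ x → (x + (q - 1ℤ)) * rising q n) (∑-elems-const (suc n) 1ℤ) ⟩
    (pos (suc n) * 1ℤ + (q - 1ℤ)) * rising q n
      ≡⟨ simplify (pos n) q (rising q n) ⟩
    rising q n * (q + pos n)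
      ≡⟨ sym (rising-suc q n) ⟩
    rising q (suc n) ∎
    where
    open ≡-Reasoning
    κ-∅ : ∀ y → κ {n} (λ _ → false) y ≡ 1ℤ
    κ-∅ zero    = refl
    κ-∅ (suc _) = refl
    other-points : ∀ y → y ≢ p → q ^ fixes0 (π y) ≡ 1ℤ
    other-points y y≢p with π y in πy
    ... | zero  = contradiction (inj (trans πy (sym πp))) y≢p
    ... | suc _ = refl
    simplify : ∀ m q r → ((1ℤ + m) * 1ℤ + (q - 1ℤ)) * r ≡ r * (q + m)
    simplify = solve-∀

  falling : ℕ → ℤ
  falling zero    = 1ℤ
  falling (suc k) = (q - pos k) * falling k

  -- On the full set `ε` is, up to a sign depending on n alone, the sign character, so this is a
  -- signed count of permutations by cycles. In the recurrence the y with θ y = 0 has weight q and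
  -- the n others -1, which gives the factor q - n.
  X-full : (θ : Fin n → Fin n) → Inj θ → X θ full ≡ ε θ full * falling n
  X-full {zero} θ inj = refl
  X-full {suc n} θ inj with surjective θ inj zero
  ... | p , θp = begin
    X θ full
      ≡⟨ X-suc θ inj full ⟩
    ∑ (elems (suc n)) (λ y → κ full y * q ^ fixes0 (θ y) * X (contract (θ ∘ transpose zero y)) full)
      ≡⟨ ∑-cong (elems (suc n)) term ⟩
    ∑ (elems (suc n)) (λ y → w (θ y) * (ε θ full * falling n))
      ≡⟨ ∑-*ʳ (ε θ full * falling n) (elems (suc n)) (w ∘ θ) ⟩
    ∑ (elems (suc n)) (w ∘ θ) * (ε θ full * falling n)
      ≡⟨ cong (_* (ε θ full * falling n)) (∑-elems-except p {g = λ _ → -1ℤ} (cong w θp) other-points) ⟩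
    (∑ (elems (suc n)) (λ _ → -1ℤ) + (q - -1ℤ)) * (ε θ full * falling n)
      ≡⟨ cong (λ x → (x + (q - -1ℤ)) * (ε θ full * falling n)) (∑-elems-const (suc n) -1ℤ) ⟩
    (pos (suc n) * -1ℤ + (q - -1ℤ)) * (ε θ full * falling n)
      ≡⟨ simplify (pos n) q (ε θ full) (falling n) ⟩
    ε θ full * ((q - pos n) * falling n) ∎
    where
    open ≡-Reasoning
    w : Fin (suc n) → ℤ
    w zero    = q
    w (suc _) = -1ℤ
    other-points : ∀ y → y ≢ p → w (θ y) ≡ -1ℤ
    other-points y y≢p with θ y in θy
    ... | zero  = contradiction (inj (trans θy (sym θp))) y≢p
    ... | suc _ = refl
    simplify : ∀ m q x f → ((1ℤ + m) * -1ℤ + (q - -1ℤ)) * (x * f) ≡ x * ((q - m) * f)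
    simplify = solve-∀
    rearrange : ∀ k a x f → k * a * (x * f) ≡ a * (k * x) * f
    rearrange = solve-∀
    module _ (y : Fin (suc n)) where
      ρ = θ ∘ transpose zero y
      injρ : Inj ρ
      injρ = ∘-Inj inj (transpose-Inj zero y)
      -- For y = 0 the minus sign comes from `κ`, otherwise from the transposition.
      flip : κ full y * ε ρ full ≡ -1ℤ * ε θ full
      flip = by-cases y refl
        where
        by-cases : ∀ z → y ≡ z → κ full z * ε (θ ∘ transpose zero z) full ≡ -1ℤ * ε θ full
        by-cases zero    refl = cong (-1ℤ *_) (ε-congˡ full (λ i → cong θ (transpose-same zero i)))
        by-cases (suc c) refl = trans (ℤ.*-identityˡ (ε (θ ∘ transpose zero y) full)) (ε-transposeʳ θ inj full zero (suc c) (λ ()) refl)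
      -- ε ρ = κ (θ y) * ε (contract ρ), and κ takes the values ±1 on the full set.
      weigh : ∀ z → z ≡ θ y → q ^ fixes0 z * (κ full y * ε (contract ρ) full) ≡ w z * ε θ full
      weigh zero eq = trans (lem₁ q (κ full y) (ε (contract ρ) full))
        (trans (cong (λ z → - (q * (κ full y * (κ full z * ε (contract ρ) full)))) eq) (trans (cong (λ x → - (q * x)) flip) (lem₂ q (ε θ full))))
        where
        lem₁ : ∀ q k x → q * 1ℤ * (k * x) ≡ - (q * (k * (-1ℤ * x)))
        lem₁ = solve-∀
        lem₂ : ∀ q x → - (q * (-1ℤ * x)) ≡ q * x
        lem₂ = solve-∀
      weigh (suc c) eq = trans (lem₁ (κ full y) (ε (contract ρ) full))
        (trans (cong (λ z → κ full y * (κ full z * ε (contract ρ) full)) eq) flip)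
        where
        lem₁ : ∀ k x → 1ℤ * (k * x) ≡ k * (1ℤ * x)
        lem₁ = solve-∀
      term : κ full y * q ^ fixes0 (θ y) * X (contract ρ) full ≡ w (θ y) * (ε θ full * falling n)
      term = begin
        κ full y * q ^ fixes0 (θ y) * X (contract ρ) full
          ≡⟨ cong (κ full y * q ^ fixes0 (θ y) *_) (X-full (contract ρ) (contract-Inj ρ injρ)) ⟩
        κ full y * q ^ fixes0 (θ y) * (ε (contract ρ) full * falling n)
          ≡⟨ rearrange (κ full y) (q ^ fixes0 (θ y)) (ε (contract ρ) full) (falling n) ⟩
        q ^ fixes0 (θ y) * (κ full y * ε (contract ρ) full) * falling n
          ≡⟨ cong (_* falling n) (weigh (θ y) refl) ⟩
        w (θ y) * ε θ full * falling n
          ≡⟨ ℤ.*-assoc (w (θ y)) (ε θ full) (falling n) ⟩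
        w (θ y) * (ε θ full * falling n) ∎

-- The long cycle i ↦ i - 1, and its action on intervals

rot : Fin n → Fin n
rot {suc n} zero    = fromℕ n
rot {suc n} (suc i) = inject₁ i

rot-Inj : Inj (rot {n})
rot-Inj {suc n} {zero}  {zero}  eq = refl
rot-Inj {suc n} {zero}  {suc j} eq = contradiction eq fromℕ≢inject₁
rot-Inj {suc n} {suc i} {zero}  eq = contradiction (sym eq) fromℕ≢inject₁
rot-Inj {suc n} {suc i} {suc j} eq = cong suc (inject₁-injective eq)

contract-rot : contract (rot {suc n}) ≗ rot
contract-rot {suc n} zero    = refl
contract-rot {suc n} (suc i) = refl

ε-rot-full : ∀ n → ε (rot {suc n}) full ≡ -1ℤ
ε-rot-full zero    = refl
ε-rot-full (suc n) = trans (ℤ.*-identityˡ (ε (contract (rot {suc (suc n)})) full))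
  (trans (ε-congˡ {ζ = contract (rot {suc (suc n)})} {rot} full contract-rot) (ε-rot-full n))

suffix : ∀ m k → Fin (m ℕ.+ k) → Bool
suffix zero    k i       = true
suffix (suc m) k zero    = false
suffix (suc m) k (suc i) = suffix m k i

suffix-↑ʳ : ∀ m {k} (i : Fin k) → suffix m k (m ↑ʳ i) ≡ true
suffix-↑ʳ zero    i = refl
suffix-↑ʳ (suc m) i = suffix-↑ʳ m i

suffix-true : ∀ m {k} (p : Fin (m ℕ.+ k)) → suffix m k p ≡ true → ∃ λ i → p ≡ m ↑ʳ i
suffix-true zero    p       eq = p , refl
suffix-true (suc m) (suc p) eq with suffix-true m p eq
... | i , refl = i , refl

∑-suffix : ∀ m k → ∑ (elems (m ℕ.+ k)) (λ y → agree false (suffix m k y)) ≡ pos m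
∑-suffix zero k = ∑-zero (elems k)
∑-suffix (suc m) k = trans (∑-elems-suc (m ℕ.+ k) (λ y → agree false (suffix (suc m) k y))) (cong (1ℤ +_) (∑-suffix m k))

-- interval N a k is the word 0ᵃ 1ᵏ 0…0 of length N, cut off if a + k > N.
interval : ∀ N → ℕ → ℕ → Vec Bool N
interval zero    a       k       = []
interval (suc N) (suc a) k       = false ∷ interval N a k
interval (suc N) zero    (suc k) = true ∷ interval N zero k
interval (suc N) zero    zero    = false ∷ interval N zero zero

interval-inject₁ : ∀ N a k i → lookup (interval (suc N) a k) (inject₁ i) ≡ lookup (interval N a k) i
interval-inject₁ (suc N) (suc a) k       zero    = refl
interval-inject₁ (suc N) zero    (suc k) zero    = refl
interval-inject₁ (suc N) zero    zero    zero    = refl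
interval-inject₁ (suc N) (suc a) k       (suc i) = interval-inject₁ N a k i
interval-inject₁ (suc N) zero    (suc k) (suc i) = interval-inject₁ N zero k i
interval-inject₁ (suc N) zero    zero    (suc i) = interval-inject₁ N zero zero i

interval-last : ∀ N a k → a ℕ.+ k ℕ.≤ N → lookup (interval (suc N) a k) (fromℕ N) ≡ false
interval-last zero    zero    zero    _           = refl
interval-last (suc N) (suc a) k       (ℕ.s≤s le)  = interval-last N a k le
interval-last (suc N) zero    (suc k) (ℕ.s≤s le)  = interval-last N zero k le
interval-last (suc N) zero    zero    _           = interval-last N zero zero ℕ.z≤n

interval-rot : ∀ N a k → a ℕ.+ k ℕ.< N →
  lookup (false ∷ interval N a k) ∘ rot ≗ lookup (false ∷ interval N (suc a) k)
interval-rot (suc N) a k (ℕ.s≤s le) zero          = interval-last N a k le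
interval-rot (suc N) a k (ℕ.s≤s le) (suc zero)    = refl
interval-rot (suc N) a k (ℕ.s≤s le) (suc (suc i)) = interval-inject₁ N a k i

interval-suffix : ∀ a k → lookup (false ∷ interval (a ℕ.+ k) a k) ≗ suffix (suc a) k
interval-suffix a k zero    = refl
interval-suffix a k (suc i) = go a k i
  where
  go : ∀ a k → lookup (interval (a ℕ.+ k) a k) ≗ suffix a k
  go zero    (suc k) zero    = refl
  go zero    (suc k) (suc i) = go zero k i
  go (suc a) k       zero    = refl
  go (suc a) k       (suc i) = go a k i

interval-zero : ∀ N i → lookup (interval N 0 0) i ≡ false
interval-zero (suc N) zero    = refl
interval-zero (suc N) (suc i) = interval-zero N i

-- Number of maximal runs of 1s in v, not counting a run that continues the letter c before v.
rises : Bool → Vec Bool n → ℕ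
rises c []           = 0
rises c (true ∷ v)   = (if c then 0 else 1) ℕ.+ rises true v
rises c (false ∷ v)  = rises false v

-- Since `rot` steps to the preceding position, a rise of `v` at `i` with `c` = `false` says that
-- the point `suc i` of S leaves S under `rot`.
Rise : Bool → Vec Bool n → Fin n → Set
Rise c v i = lookup v i ≡ true × lookup (c ∷ v) (inject₁ i) ≡ false

rise : (c : Bool) (v : Vec Bool n) → 1 ℕ.≤ rises c v → ∃ λ i → Rise c v i
rise false (true ∷ v)  le = zero , refl , refl
rise true  (true ∷ v)  le with rise true v le
... | i , p , q = suc i , p , q
rise c     (false ∷ v) le with rise false v le
... | i , p , q = suc i , p , q

two-rises : (c : Bool) (v : Vec Bool n) → 2 ℕ.≤ rises c v → ∃ λ i → ∃ λ j → i ≢ j × Rise c v i × Rise c v j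
two-rises false (true ∷ v) (ℕ.s≤s le) with rise true v le
... | i , p , q = zero , suc i , (λ ()) , (refl , refl) , (p , q)
two-rises true (true ∷ v) le with two-rises true v le
... | i , j , i≢j , p , q = suc i , suc j , i≢j ∘ suc-injective , p , q
two-rises c (false ∷ v) le with two-rises false v le
... | i , j , i≢j , p , q = suc i , suc j , i≢j ∘ suc-injective , p , q

-- Sums over words with at most one run, and telescoping

∑< : ℕ → (ℕ → ℤ) → ℤ
∑< zero    f = 0ℤ
∑< (suc m) f = f 0 + ∑< m (f ∘ suc)

-- The term `f k` occurs N - k times, once for each place of a run of length k + 1 in a word of
-- length N.
∑∑< : ℕ → (ℕ → ℤ) → ℤ
∑∑< zero    f = 0ℤ
∑∑< (suc N) f = ∑∑< N f + ∑< (suc N) f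

∑-no-rise : ∀ N {G : Vec Bool N → ℤ} → (∀ v → 1 ℕ.≤ rises false v → G v ≡ 0ℤ) →
  ∑ (subsets N) G ≡ G (interval N 0 0)
∑-no-rise zero {G} G≡0 = ℤ.+-identityʳ (G [])
∑-no-rise (suc N) {G} G≡0 = trans (∑-subsets-suc N G) (trans
  (cong₂ _+_ (trans (∑-cong (subsets N) (λ v → G≡0 (true ∷ v) (ℕ.s≤s ℕ.z≤n))) (∑-zero (subsets N)))
             (∑-no-rise N (λ v → G≡0 (false ∷ v))))
  (ℤ.+-identityˡ _))

-- Here `v` is what follows a letter 1, so the surviving words prolong that run by `k` letters and
-- then contain only 0s.
∑-initial-run : ∀ N {G : Vec Bool N → ℤ} (f : ℕ → ℤ) → (∀ v → 1 ℕ.≤ rises true v → G v ≡ 0ℤ) →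
  (∀ k → k ℕ.≤ N → G (interval N 0 k) ≡ f k) → ∑ (subsets N) G ≡ ∑< (suc N) f
∑-initial-run zero {G} f G≡0 Gf = cong (_+ 0ℤ) (Gf 0 ℕ.z≤n)
∑-initial-run (suc N) {G} f G≡0 Gf = trans (∑-subsets-suc N G) (trans
  (cong₂ _+_ (∑-initial-run N (f ∘ suc) (λ v → G≡0 (true ∷ v)) (λ k le → Gf (suc k) (ℕ.s≤s le)))
             (trans (∑-no-rise N (λ v → G≡0 (false ∷ v))) (Gf 0 ℕ.z≤n)))
  (ℤ.+-comm (∑< (suc N) (f ∘ suc)) (f 0)))

-- A word starting with 1 has its single run there, of any length up to N + 1; a word starting with
-- 0 is handled by induction, which also supplies the word without a run.
∑-intervals : ∀ N {G : Vec Bool N → ℤ} (f : ℕ → ℤ) → (∀ v → 2 ℕ.≤ rises false v → G v ≡ 0ℤ) →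
  (∀ a k → a ℕ.+ suc k ℕ.≤ N → G (interval N a (suc k)) ≡ f k) →
  ∑ (subsets N) G ≡ G (interval N 0 0) + ∑∑< N f
∑-intervals zero {G} f G≡0 Gf = refl
∑-intervals (suc N) {G} f G≡0 Gf = trans (∑-subsets-suc N G) (trans
  (cong₂ _+_ (∑-initial-run N f (λ v le → G≡0 (true ∷ v) (ℕ.s≤s le)) (λ k le → Gf 0 k (ℕ.s≤s le)))
             (∑-intervals N f (λ v → G≡0 (false ∷ v)) (λ a k le → Gf (suc a) k (ℕ.s≤s le))))
  (rearrange (∑< (suc N) f) (G (interval (suc N) 0 0)) (∑∑< N f)))
  where
  rearrange : ∀ a b c → a + (b + c) ≡ b + (c + a)
  rearrange = solve-∀

∑<-telescope : ∀ m (c : ℤ) (f h : ℕ → ℤ) → (∀ k → c * f k ≡ h (suc k) - h k) → c * ∑< m f ≡ h m - h 0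
∑<-telescope zero c f h eq = trans (ℤ.*-zeroʳ c) (sym (ℤ.+-inverseʳ (h 0)))
∑<-telescope (suc m) c f h eq = trans (ℤ.*-distribˡ-+ c (f 0) (∑< m (f ∘ suc)))
  (trans (cong₂ _+_ (eq 0) (∑<-telescope m c (f ∘ suc) (h ∘ suc) (eq ∘ suc))) (collapse (h 0) (h 1) (h (suc m))))
  where
  collapse : ∀ a b c → b - a + (c - b) ≡ c - a
  collapse = solve-∀

∑<-snoc : ∀ m f → ∑< (suc m) f ≡ ∑< m f + f m
∑<-snoc zero f = ℤ.+-comm (f 0) 0ℤ
∑<-snoc (suc m) f = trans (cong (f 0 +_) (∑<-snoc m (f ∘ suc))) (sym (ℤ.+-assoc (f 0) _ _))

∑∑<-telescope : ∀ N (c : ℤ) (f h : ℕ → ℤ) → (∀ k → c * f k ≡ h (suc k) - h k) →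
  c * ∑∑< N f ≡ ∑< (suc N) h - pos (suc N) * h 0
∑∑<-telescope zero c f h eq = trans (ℤ.*-zeroʳ c) (sym (cancel (h 0)))
  where
  cancel : ∀ x → x + 0ℤ - 1ℤ * x ≡ 0ℤ
  cancel = solve-∀
∑∑<-telescope (suc N) c f h eq = begin
  c * (∑∑< N f + ∑< (suc N) f)
    ≡⟨ ℤ.*-distribˡ-+ c (∑∑< N f) (∑< (suc N) f) ⟩
  c * ∑∑< N f + c * ∑< (suc N) f
    ≡⟨ cong₂ _+_ (∑∑<-telescope N c f h eq) (∑<-telescope (suc N) c f h eq) ⟩
  ∑< (suc N) h - pos (suc N) * h 0 + (h (suc N) - h 0)
    ≡⟨ rearrange (∑< (suc N) h) (pos (suc N)) (h 0) (h (suc N)) ⟩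
  ∑< (suc N) h + h (suc N) - (1ℤ + pos (suc N)) * h 0
    ≡⟨ cong (_- pos (suc (suc N)) * h 0) (sym (∑<-snoc (suc N) h)) ⟩
  ∑< (suc (suc N)) h - pos (suc (suc N)) * h 0 ∎
  where
  open ≡-Reasoning
  rearrange : ∀ s n a b → s - n * a + (b - a) ≡ s + b - (1ℤ + n) * a
  rearrange = solve-∀

-- The sum over long cycles when π is `rot`

module LongCycle (q : ℤ) where
  open Evaluation q

  -- Inside the suffix S, π acts as θ, except that `s` exits to the last point before S. With r > 1
  -- points before S, deleting 0 leaves this exit point in place; r choices of y avoid S, one of
  -- them with weight q, so the factor is q + r - 1. When only the exit point remains, its deletion
  -- gives the factor 1 and turns π into θ.
  X-suffix : ∀ m {k} (θ : Fin k → Fin k) → Inj θ → (s : Fin k) (π : Fin (suc m ℕ.+ k) → Fin (suc m ℕ.+ k)) → Inj π →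
    π (suc m ↑ʳ s) ≡ fromℕ m ↑ˡ k → (∀ i → i ≢ s → π (suc m ↑ʳ i) ≡ suc m ↑ʳ θ i) →
    X π (suffix (suc m) k) ≡ rising (q + 1ℤ) m * X θ full
  X-suffix zero {k} θ injθ s π inj exit inside = begin
    X π (suffix 1 k)
      ≡⟨ X-suc π inj (suffix 1 k) ⟩
    ∑ (elems (suc k)) term
      ≡⟨ ∑-elems-except zero {g = λ _ → 0ℤ} {a = X θ full} at-zero elsewhere ⟩
    ∑ (elems (suc k)) (λ _ → 0ℤ) + (X θ full - 0ℤ)
      ≡⟨ cong (_+ (X θ full - 0ℤ)) (∑-zero (elems (suc k))) ⟩
    0ℤ + (X θ full - 0ℤ)
      ≡⟨ simplify (X θ full) ⟩
    1ℤ * X θ full ∎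
    where
    open ≡-Reasoning
    simplify : ∀ x → 0ℤ + (x - 0ℤ) ≡ 1ℤ * x
    simplify = solve-∀
    term : Fin (suc k) → ℤ
    term y = κ (suffix 1 k) y * q ^ fixes0 (π y) * X (contract (π ∘ transpose zero y)) full
    agree-off-s : ∀ i → i ≢ s → contract π i ≡ θ i
    agree-off-s i i≢s = contract-suc π (inside i i≢s)
    contract≗θ : contract π ≗ θ
    contract≗θ i with i ≟ s
    ... | no i≢s = agree-off-s i i≢s
    -- Two injections that agree everywhere except at `s` agree at `s` too.
    ... | yes refl with surjective θ injθ (contract π i)
    ...   | j , θj with j ≟ i
    ...     | yes refl = sym θj
    ...     | no j≢i = contradiction (contract-Inj π inj (trans (agree-off-s j j≢i) θj)) j≢i
    at-zero : term zero ≡ X θ full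
    at-zero = trans (cong (λ x → 1ℤ * q ^ x * X (contract (π ∘ transpose zero zero)) full) no-fix)
      (trans (ℤ.*-identityˡ (X (contract (π ∘ transpose zero zero)) full))
        (X-cong (λ i → trans (contract-cong (λ j → cong π (transpose-same zero j)) i) (contract≗θ i)) (λ _ → refl)))
      where
      no-fix : fixes0 (π zero) ≡ 0
      no-fix with π zero in π0
      ... | zero  = contradiction (inj (trans π0 (sym exit))) λ ()
      ... | suc _ = refl
    elsewhere : ∀ y → y ≢ zero → term y ≡ 0ℤ
    elsewhere zero    y≢0 = contradiction refl y≢0
    elsewhere (suc c) _   = vanish (q ^ fixes0 (π (suc c))) (X (contract (π ∘ transpose zero (suc c))) full)
      where
      vanish : ∀ a b → 0ℤ * a * b ≡ 0ℤ
      vanish = solve-∀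
  X-suffix (suc m) {k} θ injθ s π inj exit inside with surjective π inj zero
  ... | p , πp = begin
    X π S
      ≡⟨ X-suc π inj S ⟩
    ∑ (elems n′) (λ y → κ S y * q ^ fixes0 (π y) * X (contract (π ∘ transpose zero y)) (suffix (suc m) k))
      ≡⟨ ∑-cong (elems n′) term ⟩
    ∑ (elems n′) (λ y → agree false (S y) * q ^ fixes0 (π y) * V)
      ≡⟨ ∑-*ʳ V (elems n′) (λ y → agree false (S y) * q ^ fixes0 (π y)) ⟩
    ∑ (elems n′) (λ y → agree false (S y) * q ^ fixes0 (π y)) * V
      ≡⟨ cong (_* V) (∑-elems-except p {g = λ y → agree false (S y)} {a = q} at-p elsewhere) ⟩
    (∑ (elems n′) (λ y → agree false (S y)) + (q - agree false (S p))) * V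
      ≡⟨ cong₂ (λ x b → (x + (q - agree false b)) * V) (∑-suffix (suc (suc m)) k) Sp ⟩
    (pos (suc (suc m)) + (q - 1ℤ)) * (rising (q + 1ℤ) m * X θ full)
      ≡⟨ rearrange (pos m) q (rising (q + 1ℤ) m) (X θ full) ⟩
    rising (q + 1ℤ) m * (q + 1ℤ + pos m) * X θ full
      ≡⟨ cong (_* X θ full) (sym (rising-suc (q + 1ℤ) m)) ⟩
    rising (q + 1ℤ) (suc m) * X θ full ∎
    where
    open ≡-Reasoning
    n′ = suc (suc m) ℕ.+ k
    S = suffix (suc (suc m)) k
    V = rising (q + 1ℤ) m * X θ full
    rearrange : ∀ m q r x → (1ℤ + (1ℤ + m) + (q - 1ℤ)) * (r * x) ≡ r * (q + 1ℤ + m) * x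
    rearrange = solve-∀
    Sp : S p ≡ false
    Sp with S p in eq
    ... | false = refl
    ... | true with suffix-true (suc (suc m)) p eq
    ...   | i , refl with i ≟ s
    ...     | yes refl = contradiction (trans (sym πp) exit) λ ()
    ...     | no i≢s = contradiction (trans (sym πp) (inside i i≢s)) λ ()
    at-p : agree false (S p) * q ^ fixes0 (π p) ≡ q
    at-p = trans (cong₂ (λ b z → agree false b * q ^ fixes0 z) Sp πp) (simplify q)
      where
      simplify : ∀ q → 1ℤ * (q * 1ℤ) ≡ q
      simplify = solve-∀
    elsewhere : ∀ y → y ≢ p → agree false (S y) * q ^ fixes0 (π y) ≡ agree false (S y)
    elsewhere y y≢p with π y in πy
    ... | zero  = contradiction (inj (trans πy (sym πp))) y≢p
    ... | suc _ = ℤ.*-identityʳ (agree false (S y))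
    κ≡ : ∀ y → κ S y ≡ agree false (S y)
    κ≡ zero    = refl
    κ≡ (suc y) = refl
    term : ∀ y → κ S y * q ^ fixes0 (π y) * X (contract (π ∘ transpose zero y)) (suffix (suc m) k)
      ≡ agree false (S y) * q ^ fixes0 (π y) * V
    term y with S y in Sy | κ≡ y
    ... | true  | κy = trans (cong (λ x → x * q ^ fixes0 (π y) * X (contract (π ∘ transpose zero y)) (suffix (suc m) k)) κy)
                         (vanish (q ^ fixes0 (π y)) (X (contract (π ∘ transpose zero y)) (suffix (suc m) k)) V)
      where
      vanish : ∀ a b c → 0ℤ * a * b ≡ 0ℤ * a * c
      vanish = solve-∀
    ... | false | κy = cong₂ (λ x z → x * q ^ fixes0 (π y) * z) κy
        (X-suffix m θ injθ s (contract ρ) (contract-Inj ρ (∘-Inj inj (transpose-Inj zero y)))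
          (contract-suc ρ (trans (untouched s) exit)) (λ i i≢s → contract-suc ρ (trans (untouched i) (inside i i≢s))))
      where
      ρ = π ∘ transpose zero y
      untouched : ∀ i → ρ (suc (suc m) ↑ʳ i) ≡ π (suc (suc m) ↑ʳ i)
      untouched i = cong π (transpose-other zero y (λ ()) (λ eq → contradiction
        (trans (sym (suffix-↑ʳ (suc (suc m)) i)) (trans (cong S eq) Sy)) λ ()))

  falling-rising : ∀ k a → falling k * rising (q + 1ℤ) a ≡ rising (q - pos k + 1ℤ) (k ℕ.+ a)
  falling-rising zero a = trans (ℤ.*-identityˡ (rising (q + 1ℤ) a)) (cong (λ x → rising (x + 1ℤ) a) (sym (ℤ.+-identityʳ q)))
  falling-rising (suc k) a = begin
    (q - pos k) * falling k * rising (q + 1ℤ) a   ≡⟨ ℤ.*-assoc (q - pos k) (falling k) (rising (q + 1ℤ) a) ⟩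
    (q - pos k) * (falling k * rising (q + 1ℤ) a) ≡⟨ cong ((q - pos k) *_) (falling-rising k a) ⟩
    rising (q - pos k) (suc k ℕ.+ a)              ≡⟨ cong (λ x → rising x (suc k ℕ.+ a)) (shift q (pos k)) ⟩
    rising (q - pos (suc k) + 1ℤ) (suc k ℕ.+ a)   ∎
    where
    open ≡-Reasoning
    shift : ∀ q k → q - k ≡ q - (1ℤ + k) + 1ℤ
    shift = solve-∀

  -- `d` is the distance of the run from the end of the word, and `X-rotate` shifts the run
  -- rightwards until it is a suffix. There the falling factors of the run and the rising factors of
  -- the `a` + 1 points before it join into consecutive factors; the minus sign is that of a single
  -- cycle filling the run.
  X-interval : ∀ d a k N → d ℕ.+ (a ℕ.+ suc k) ≡ N → X rot (lookup (false ∷ interval N a (suc k))) ≡ - rising (q - pos k) N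
  X-interval zero a k _ refl = begin
    X rot (lookup (false ∷ interval (a ℕ.+ suc k) a (suc k)))
      ≡⟨ X-cong {π = rot} {rot} (λ _ → refl) (interval-suffix a (suc k)) ⟩
    X rot (suffix (suc a) (suc k))
      ≡⟨ X-suffix a rot rot-Inj zero rot rot-Inj exit inside ⟩
    rising (q + 1ℤ) a * X (rot {suc k}) full
      ≡⟨ cong (rising (q + 1ℤ) a *_) (trans (X-full (rot {suc k}) rot-Inj) (cong (_* falling (suc k)) (ε-rot-full k))) ⟩
    rising (q + 1ℤ) a * (-1ℤ * falling (suc k))
      ≡⟨ rearrange (rising (q + 1ℤ) a) (falling (suc k)) ⟩
    - (falling (suc k) * rising (q + 1ℤ) a)
      ≡⟨ cong -_ (falling-rising (suc k) a) ⟩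
    - rising (q - pos (suc k) + 1ℤ) (suc k ℕ.+ a)
      ≡⟨ cong₂ (λ x m → - rising x m) (shift q (pos k)) (ℕ.+-comm (suc k) a) ⟩
    - rising (q - pos k) (a ℕ.+ suc k) ∎
    where
    open ≡-Reasoning
    rearrange : ∀ r f → r * (-1ℤ * f) ≡ - (f * r)
    rearrange = solve-∀
    shift : ∀ q k → q - (1ℤ + k) + 1ℤ ≡ q - k
    shift = solve-∀
    exit : rot (suc a ↑ʳ zero {k}) ≡ fromℕ a ↑ˡ suc k
    exit = toℕ-injective (trans (toℕ-inject₁ (a ↑ʳ zero)) (trans (toℕ-↑ʳ a zero) (trans (ℕ.+-identityʳ a)
      (sym (trans (toℕ-↑ˡ (fromℕ a) (suc k)) (toℕ-fromℕ a))))))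
    inside : ∀ i → i ≢ zero → rot (suc a ↑ʳ i) ≡ suc a ↑ʳ rot {suc k} i
    inside zero    i≢0 = contradiction refl i≢0
    inside (suc i) _   = toℕ-injective (trans (toℕ-inject₁ (a ↑ʳ suc i)) (trans (toℕ-↑ʳ a (suc i)) (trans (ℕ.+-suc a (toℕ i))
      (sym (trans (toℕ-↑ʳ (suc a) (inject₁ i)) (cong (suc a ℕ.+_) (toℕ-inject₁ i)))))))
  X-interval (suc d) a k _ refl = trans
    (sym (X-rotate rot rot-Inj (lookup (false ∷ interval N a (suc k)))))
    (trans (X-cong {π = rot} {rot} (λ _ → refl) (interval-rot N a (suc k) (ℕ.s≤s (ℕ.m≤n+m (a ℕ.+ suc k) d))))
      (X-interval d (suc a) k N (ℕ.+-suc d (a ℕ.+ suc k))))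
    where
    N = suc d ℕ.+ (a ℕ.+ suc k)

  -- Both summations use rising (a - 1) (M + 1) - rising a (M + 1) = -(M + 1) · rising a M, with M =
  -- N for the run lengths and M = N + 1 for the resulting sum; this is the origin of the two
  -- multipliers.
  Φ-rot : ∀ N → pos (suc (suc N)) * (pos (suc N) * Φ (rot {suc N})) ≡ rising q (suc (suc N)) - rising (q - pos (suc N)) (suc (suc N))
  Φ-rot N = begin
    pos (suc (suc N)) * (pos (suc N) * Φ (rot {suc N}))
      ≡⟨ cong (λ x → pos (suc (suc N)) * (pos (suc N) * x)) total ⟩
    pos (suc (suc N)) * (pos (suc N) * (h 0 + ∑∑< N f))
      -- The empty set contributes `h 0`, which cancels the boundary term of the first telescoping.
      ≡⟨ cong (pos (suc (suc N)) *_) (trans (ℤ.*-distribˡ-+ (pos (suc N)) (h 0) (∑∑< N f))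
           (trans (cong (pos (suc N) * h 0 +_) (∑∑<-telescope N (pos (suc N)) f h h-step)) (cancel (pos (suc N) * h 0) (∑< (suc N) h)))) ⟩
    pos (suc (suc N)) * ∑< (suc N) h
      ≡⟨ flip-sign (pos (suc (suc N))) (∑< (suc N) h) ⟩
    - ((- pos (suc (suc N))) * ∑< (suc N) h)
      ≡⟨ cong -_ (∑<-telescope (suc N) (- pos (suc (suc N))) h K K-step) ⟩
    - (K (suc N) - K 0)
      ≡⟨ swap (K (suc N)) (K 0) ⟩
    K 0 - K (suc N)
      ≡⟨ cong (λ x → rising x (suc (suc N)) - K (suc N)) (ℤ.+-identityʳ q) ⟩
    rising q (suc (suc N)) - K (suc N) ∎
    where
    open ≡-Reasoning
    f h K : ℕ → ℤ
    f k = - rising (q - pos k) N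
    h k = rising (q - pos k) (suc N)
    K k = rising (q - pos k) (suc (suc N))
    cancel : ∀ a b → a + (b - a) ≡ b
    cancel = solve-∀
    flip-sign : ∀ a b → a * b ≡ - ((- a) * b)
    flip-sign = solve-∀
    swap : ∀ a b → - (a - b) ≡ b - a
    swap = solve-∀
    shift : ∀ q k → q - (1ℤ + k) + 1ℤ ≡ q - k
    shift = solve-∀
    h-step : ∀ k → pos (suc N) * f k ≡ h (suc k) - h k
    h-step k = trans (expand (pos N) q (pos k) (rising (q - pos k) N)) (cong₂ _-_
      (cong (λ x → (q - pos (suc k)) * rising x N) (sym (shift q (pos k)))) (sym (rising-suc (q - pos k) N)))
      where
      expand : ∀ N q k r → (1ℤ + N) * (- r) ≡ (q - (1ℤ + k)) * r - r * (q - k + N)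
      expand = solve-∀
    K-step : ∀ k → - pos (suc (suc N)) * h k ≡ K (suc k) - K k
    K-step k = trans (expand (pos N) q (pos k) (rising (q - pos k) (suc N))) (cong₂ _-_
      (cong (λ x → (q - pos (suc k)) * rising x (suc N)) (sym (shift q (pos k)))) (sym (rising-suc (q - pos k) (suc N))))
      where
      expand : ∀ N q k r → - (1ℤ + (1ℤ + N)) * r ≡ (q - (1ℤ + k)) * r - r * (q - k + (1ℤ + N))
      expand = solve-∀
    total : Φ (rot {suc N}) ≡ h 0 + ∑∑< N f
    total = trans (Φ-expand (rot {suc N})) (trans
      (∑-intervals N {λ v → X rot (lookup (false ∷ v))} f
        (λ v le → vanish v (two-rises false v le))
        (λ a k le → X-interval (N ℕ.∸ (a ℕ.+ suc k)) a k N (ℕ.m∸n+n≡m le)))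
      (cong (_+ ∑∑< N f) (trans (X-cong {π = rot} {rot} {lookup (false ∷ interval N 0 0)} (λ _ → refl) (λ { zero → refl ; (suc i) → interval-zero N i }))
        (trans (X-∅ (rot {suc N}) rot-Inj) (cong (λ x → rising x (suc N)) (sym (ℤ.+-identityʳ q)))))))
      where
      vanish : ∀ v → (∃ λ i → ∃ λ j → i ≢ j × Rise false v i × Rise false v j) → X rot (lookup (false ∷ v)) ≡ 0ℤ
      vanish v (i , j , i≢j , (p , p′) , (r , r′)) =
        X-two-exits rot rot-Inj (lookup (false ∷ v)) (suc i) (suc j) (i≢j ∘ suc-injective) p r p′ r′

-- Every long cycle is conjugate to rot

iter-comm : (σ : Fin n → Fin n) → ∀ m i → iter σ m (σ i) ≡ σ (iter σ m i)
iter-comm σ zero    i = refl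
iter-comm σ (suc m) i = cong σ (iter-comm σ m i)

iter-Inj : (σ : Fin n → Fin n) → Inj σ → ∀ m → Inj (iter σ m)
iter-Inj σ inj zero    eq = eq
iter-Inj σ inj (suc m) eq = iter-Inj σ inj m (inj eq)

rot-reach : (i : Fin (suc n)) → ∃ λ m → iter rot m (fromℕ n) ≡ i
rot-reach = >-weakInduction (λ i → ∃ λ m → iter rot m (fromℕ _) ≡ i) (0 , refl)
  (λ i (m , eq) → suc m , cong rot eq)

-- The prescribed value `c` carries the induction: for `lift 1 g′` to conjugate at 0, `g′` must send
-- the last point to the predecessor of π 0. Any other `c` is then reached by composing with a power
-- of `rot`, which commutes with `rot`.
long-cycle-conj-rot : (π : Fin (suc n) → Fin (suc n)) → Inj π → cyc π ≡ 1 →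
  ∀ c → ∃ λ g → Inj g × g (fromℕ n) ≡ c × π ∘ g ≗ g ∘ rot
long-cycle-conj-rot {zero} π inj one zero = id , id , refl , λ { zero → unique (π zero) }
  where
  unique : (i : Fin 1) → i ≡ zero
  unique zero = refl
long-cycle-conj-rot {suc n} π inj one c = by-cases (π zero) refl
  where
  by-cases : ∀ z → π zero ≡ z → ∃ λ g → Inj g × g (fromℕ (suc n)) ≡ c × π ∘ g ≗ g ∘ rot
  by-cases zero π0 with cyc-positive (contract π)
  ... | m , eq = contradiction (trans (sym one) (cong₂ (λ z k → fixes0 z ℕ.+ k) π0 eq)) λ ()
  by-cases (suc c₀) π0
    with long-cycle-conj-rot (contract π) (contract-Inj π inj) (trans (cong (λ z → fixes0 z ℕ.+ cyc (contract π)) (sym π0)) one) c₀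
  ... | g′ , injg′ , g′last , conj with surjective (lift 1 g′) (lift-Inj injg′) c
  ...   | i , gi with rot-reach i
  ...     | m , reach = g ∘ iter rot m , ∘-Inj (lift-Inj injg′) (iter-Inj rot rot-Inj m) , trans (cong g reach) gi ,
              λ j → trans (conj′ (iter rot m j)) (cong g (sym (iter-comm rot m j)))
    where
    g = lift 1 g′
    conj′ : π ∘ g ≗ g ∘ rot
    conj′ zero = trans π0 (cong suc (sym g′last))
    conj′ (suc zero) with image π inj (g′ zero)
    ... | via0 p _ _   = p
    ... | direct p p′ = contradiction (inj (trans p (trans (cong suc (trans (sym p′) (trans (conj zero) g′last))) (sym π0)))) λ ()
    conj′ (suc (suc i)) with image π inj (g′ (suc i))
    ... | direct p p′ = trans p (cong suc (trans (sym p′) (conj (suc i))))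
    ... | via0 p₁ p₂ p′ = contradiction (injg′ (trans g′last (trans (suc-injective (trans (sym π0) p₂)) (trans (sym p′) (conj (suc i)))))) fromℕ≢inject₁

-- Counting cycles by their maxima

iter-+ : (σ : Fin n → Fin n) → ∀ a b i → iter σ (a ℕ.+ b) i ≡ iter σ a (iter σ b i)
iter-+ σ zero    b i = refl
iter-+ σ (suc a) b i = cong σ (iter-+ σ a b i)

iter-period : (σ : Fin n → Fin n) {p : ℕ} {i : Fin n} → iter σ p i ≡ i → ∀ k → iter σ (k ℕ.* p) i ≡ i
iter-period σ eq zero = refl
iter-period σ {p} {i} eq (suc k) = trans (iter-+ σ p (k ℕ.* p) i) (trans (cong (iter σ p) (iter-period σ eq k)) eq)

-- Orbit tests look only at exponents below n. By the pigeonhole principle and injectivity the point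
-- has a period p ≤ n, and exponents may be reduced modulo p.
iter-bounded : (σ : Fin n → Fin n) → Inj σ → ∀ m i → ∃ λ m′ → m′ ℕ.< n × iter σ m′ i ≡ iter σ m i
iter-bounded {n} σ inj m i with pigeonhole (ℕ.n<1+n n) (λ a → iter σ (toℕ a) i)
... | a , b , a<b , eq = m % p , ℕ.<-≤-trans (m%n<n m p) p≤n ,
      sym (trans (cong (λ k → iter σ k i) (m≡m%n+[m/n]*n m p))
        (trans (iter-+ σ (m % p) _ i) (cong (iter σ (m % p)) (iter-period σ period (m / p)))))
  where
  p = toℕ b ℕ.∸ toℕ a
  instance
    p≢0 : ℕ.NonZero p
    p≢0 = ℕ.>-nonZero (ℕ.m<n⇒0<n∸m a<b)
  p≤n : p ℕ.≤ n
  p≤n = ℕ.≤-trans (ℕ.m∸n≤m (toℕ b) (toℕ a)) (toℕ≤pred[n] b)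
  period : iter σ p i ≡ i
  period = iter-Inj σ inj (toℕ a) (trans (sym (iter-+ σ (toℕ a) p i))
    (trans (cong (λ k → iter σ k i) (ℕ.m+[n∸m]≡n (ℕ.<⇒≤ a<b))) (sym eq)))

isOrbitMax : (Fin n → Fin n) → Fin n → Bool
isOrbitMax {n} σ i = allB (λ m → toℕ (iter σ m i) ≤ᵇ toℕ i) (upTo n)

OrbitMax : (Fin n → Fin n) → Fin n → Set
OrbitMax σ i = ∀ m → toℕ (iter σ m i) ℕ.≤ toℕ i

≤ᵇ-true : ∀ {a b} → (a ≤ᵇ b) ≡ true → a ℕ.≤ b
≤ᵇ-true {a} {b} eq = ℕ.≤ᵇ⇒≤ a b (subst T (sym eq) tt)

true-≤ᵇ : ∀ {a b} → a ℕ.≤ b → (a ≤ᵇ b) ≡ true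
true-≤ᵇ {a} {b} le with a ≤ᵇ b | ℕ.≤⇒≤ᵇ le
... | true | _ = refl

allB-upTo : (p : ℕ → Bool) → ∀ n → allB p (upTo n) ≡ true → ∀ m → m ℕ.< n → p m ≡ true
allB-upTo p n = go n id
  where
  go : ∀ n (h : ℕ → ℕ) → allB p (applyUpTo h n) ≡ true → ∀ m → m ℕ.< n → p (h m) ≡ true
  go (suc n) h eq m m<n with p (h 0) in eq₀
  go (suc n) h eq zero    _           | true = eq₀
  go (suc n) h eq (suc m) (ℕ.s≤s m<n) | true = go n (h ∘ suc) eq m m<n

isOrbitMax⇒OrbitMax : (σ : Fin n → Fin n) → Inj σ → ∀ i → isOrbitMax σ i ≡ true → OrbitMax σ i
isOrbitMax⇒OrbitMax {n} σ inj i eq m with iter-bounded σ inj m i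
... | m′ , m′<n , same = subst (λ x → toℕ x ℕ.≤ toℕ i) same (≤ᵇ-true (allB-upTo _ n eq m′ m′<n))

OrbitMax⇒isOrbitMax : (σ : Fin n → Fin n) → ∀ i → OrbitMax σ i → isOrbitMax σ i ≡ true
OrbitMax⇒isOrbitMax {n} σ i max = allB-intro (λ m → true-≤ᵇ (max m)) (upTo n)

bool-⇔ : {b c : Bool} → (b ≡ true → c ≡ true) → (c ≡ true → b ≡ true) → b ≡ c
bool-⇔ {true}  {c}     f g = sym (f refl)
bool-⇔ {false} {true}  f g = g refl
bool-⇔ {false} {false} f g = refl

module _ (σ : Fin (suc n) → Fin (suc n)) (inj : Inj σ) where

  iter-contract : ∀ i m → ∃ λ m′ → iter σ m′ (suc i) ≡ suc (iter (contract σ) m i)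
  iter-contract i zero = 0 , refl
  iter-contract i (suc m) with iter-contract i m | image σ inj (iter (contract σ) m i)
  ... | m′ , eq | direct p p′   = suc m′ , trans (cong σ eq) (trans p (cong suc (sym p′)))
  ... | m′ , eq | via0 p₁ p₂ p′ = suc (suc m′) , trans (cong σ (trans (cong σ eq) p₁)) (trans p₂ (cong suc (sym p′)))

  -- The orbit under σ is the contracted orbit with 0 possibly inserted. At 0 the next point is
  -- recorded, so that the induction can continue from there.
  contract-iter : ∀ i m → (∃ λ m′ → iter σ m (suc i) ≡ suc (iter (contract σ) m′ i)) ⊎
    (iter σ m (suc i) ≡ zero × ∃ λ m′ → σ zero ≡ suc (iter (contract σ) m′ i))
  contract-iter i zero = inj₁ (0 , refl)
  contract-iter i (suc m) with contract-iter i m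
  ... | inj₂ (eq , m′ , eq′) = inj₁ (m′ , trans (cong σ eq) eq′)
  ... | inj₁ (m′ , eq) with image σ inj (iter (contract σ) m′ i)
  ...   | direct p p′   = inj₁ (suc m′ , trans (cong σ eq) (trans p (cong suc (sym p′))))
  ...   | via0 p₁ p₂ p′ = inj₂ (trans (cong σ eq) p₁ , suc m′ , trans p₂ (cong suc (sym p′)))

  isOrbitMax-contract : ∀ i → isOrbitMax σ (suc i) ≡ isOrbitMax (contract σ) i
  isOrbitMax-contract i = bool-⇔
    (λ eq → OrbitMax⇒isOrbitMax (contract σ) i (down (isOrbitMax⇒OrbitMax σ inj (suc i) eq)))
    (λ eq → OrbitMax⇒isOrbitMax σ (suc i) (up (isOrbitMax⇒OrbitMax (contract σ) (contract-Inj σ inj) i eq)))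
    where
    down : OrbitMax σ (suc i) → OrbitMax (contract σ) i
    down max m with iter-contract i m
    ... | m′ , eq = ℕ.s≤s⁻¹ (subst (λ x → toℕ x ℕ.≤ suc (toℕ i)) eq (max m′))
    up : OrbitMax (contract σ) i → OrbitMax σ (suc i)
    up max m with contract-iter i m
    ... | inj₁ (m′ , eq) = subst (λ x → toℕ x ℕ.≤ suc (toℕ i)) (sym eq) (ℕ.s≤s (max m′))
    ... | inj₂ (eq , _)  = subst (λ x → toℕ x ℕ.≤ suc (toℕ i)) (sym eq) ℕ.z≤n

  isOrbitMax-zero : (if isOrbitMax σ zero then 1ℤ else 0ℤ) ≡ pos (fixes0 (σ zero))
  isOrbitMax-zero = by-cases (σ zero) refl
    where
    by-cases : ∀ z → σ zero ≡ z → (if isOrbitMax σ zero then 1ℤ else 0ℤ) ≡ pos (fixes0 z)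
    by-cases zero σ0 = cong (if_then 1ℤ else 0ℤ) (OrbitMax⇒isOrbitMax σ zero (λ m → ℕ.≤-reflexive (cong toℕ (fixed m))))
      where
      fixed : ∀ m → iter σ m zero ≡ zero
      fixed zero    = refl
      fixed (suc m) = trans (cong σ (fixed m)) σ0
    by-cases (suc c) σ0 with isOrbitMax σ zero in eq
    ... | false = refl
    ... | true  = contradiction (subst (λ x → toℕ x ℕ.≤ 0) σ0 (isOrbitMax⇒OrbitMax σ inj zero eq 1)) λ ()

∑-isOrbitMax : (σ : Fin n → Fin n) → Inj σ → ∑ (elems n) (λ i → if isOrbitMax σ i then 1ℤ else 0ℤ) ≡ pos (cyc σ)
∑-isOrbitMax {zero} σ inj = refl
∑-isOrbitMax {suc n} σ inj = trans (∑-elems-suc n (λ i → if isOrbitMax σ i then 1ℤ else 0ℤ)) (trans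
  (cong₂ _+_ (isOrbitMax-zero σ inj) (trans (∑-cong (elems n) (λ i → cong (if_then 1ℤ else 0ℤ) (isOrbitMax-contract σ inj i)))
    (∑-isOrbitMax (contract σ) (contract-Inj σ inj))))
  (sym (ℤ.pos-+ (fixes0 (σ zero)) (cyc (contract σ)))))

∑-elems-involution : (h : Fin n → Fin n) → (∀ i → h (h i) ≡ i) → (f : Fin n → ℤ) → ∑ (elems n) (f ∘ h) ≡ ∑ (elems n) f
∑-elems-involution {n} h hh f =
  ∑-double-counting {P = λ _ → ⊤} {Q = λ _ → ⊤} {R = λ i j → h i ≡ j} (λ i j → h i ≟ j)
    (All.universal (λ _ → tt) (elems n)) (All.universal (λ _ → tt) (elems n))
    (λ i _ → trans (∑-cong (elems n) (λ j → 𝟙-⇔ (h i ≟ j) (j ≟ h i) sym sym)) (∑-elems-𝟙 n (h i)))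
    (λ j _ → trans (∑-cong (elems n) (λ i → 𝟙-⇔ (h i ≟ j) (i ≟ h j)
       (λ eq → trans (sym (hh i)) (cong h eq)) (λ eq → trans (cong h eq) (hh j)))) (∑-elems-𝟙 n (h j)))
    (λ i j eq → cong f eq)

pos-count : (p : A → Bool) (xs : List A) → pos (count p xs) ≡ ∑ xs (λ x → if p x then 1ℤ else 0ℤ)
pos-count p [] = refl
pos-count p (x ∷ xs) with p x
... | true  = cong (1ℤ +_) (pos-count p xs)
... | false = trans (pos-count p xs) (sym (ℤ.+-identityˡ _))

opposite-≤ : {i j : Fin n} → toℕ i ℕ.≤ toℕ j → toℕ (opposite j) ℕ.≤ toℕ (opposite i)
opposite-≤ {n} {i} {j} le = subst₂ ℕ._≤_ (sym (opposite-prop j)) (sym (opposite-prop i)) (ℕ.∸-monoʳ-≤ n (ℕ.s≤s le))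

-- contract deletes the least point, which preserves the maxima of cycles but not their
-- minima; reversing the order of Fin n exchanges the two.
cycles≡cyc : (σ : Fin n → Fin n) → Inj σ → cycles σ ≡ cyc σ
cycles≡cyc {n} σ inj = ℤ.+-injective (begin
  pos (cycles σ)
    ≡⟨ pos-count (isOrbitMin σ) (elems n) ⟩
  ∑ (elems n) (λ i → if isOrbitMin σ i then 1ℤ else 0ℤ)
    ≡⟨ ∑-cong (elems n) (λ i → cong (if_then 1ℤ else 0ℤ) (reverse i (upTo n))) ⟩
  ∑ (elems n) (λ i → if isOrbitMax τ (opposite i) then 1ℤ else 0ℤ)
    ≡⟨ ∑-elems-involution opposite opposite-involutive (λ i → if isOrbitMax τ i then 1ℤ else 0ℤ) ⟩
  ∑ (elems n) (λ i → if isOrbitMax τ i then 1ℤ else 0ℤ)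
    ≡⟨ ∑-isOrbitMax τ (λ eq → oppInj (inj (oppInj eq))) ⟩
  pos (cyc τ)
    ≡⟨ cong pos (cyc-conj {g = opposite} {opposite} opposite-involutive opposite-involutive σ inj) ⟩
  pos (cyc σ) ∎)
  where
  open ≡-Reasoning
  τ = opposite ∘ σ ∘ opposite
  oppInj : Inj (opposite {n})
  oppInj = inverse-Inj {f = opposite} {opposite} opposite-involutive
  iter-opposite : ∀ m i → iter τ m (opposite i) ≡ opposite (iter σ m i)
  iter-opposite zero i = refl
  iter-opposite (suc m) i = cong (opposite ∘ σ) (trans (cong opposite (iter-opposite m i)) (opposite-involutive _))
  compare : ∀ i m → (toℕ i ≤ᵇ toℕ (iter σ m i)) ≡ (toℕ (iter τ m (opposite i)) ≤ᵇ toℕ (opposite i))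
  compare i m rewrite iter-opposite m i = bool-⇔
    (λ eq → true-≤ᵇ (opposite-≤ {i = i} {iter σ m i} (≤ᵇ-true eq)))
    (λ eq → true-≤ᵇ (subst₂ (λ x y → toℕ x ℕ.≤ toℕ y) (opposite-involutive i) (opposite-involutive (iter σ m i))
              (opposite-≤ (≤ᵇ-true eq))))
  reverse : ∀ i ms → allB (λ m → toℕ i ≤ᵇ toℕ (iter σ m i)) ms ≡ allB (λ m → toℕ (iter τ m (opposite i)) ≤ᵇ toℕ (opposite i)) ms
  reverse i [] = refl
  reverse i (m ∷ ms) = cong₂ _∧_ (compare i m) (reverse i ms)

-- Extraction of coefficients

module _ (q : ℤ) where
  open Evaluation q
  open LongCycle q

  Φ-conj : {π ρ g : Fin n → Fin n} → Inj ρ → Inj g → π ∘ g ≗ g ∘ ρ → Φ π ≡ Φ ρ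
  Φ-conj {n} {π} {ρ} {g} injρ injg conj with inverse g injg
  ... | h , gh , hg = trans
    (sym (∑-Sym-translate g h injg (inverse-Inj {f = g} {h} gh)
      {λ ζ → 𝟙 (cyc ζ ℕ.≟ 1) * q ^ cyc (π ∘ ζ)}
      (λ eq → cong₂ (λ a b → 𝟙 (a ℕ.≟ 1) * q ^ b) (cyc-cong eq) (cyc-cong (λ i → cong π (eq i))))))
    (∑-cong-All (Sym-Inj n) (λ ζ injζ → cong₂ (λ a b → 𝟙 (a ℕ.≟ 1) * q ^ b)
      (cyc-conj {g = h} {g} hg gh ζ injζ)
      (trans (cyc-cong (λ i → conj (ζ (h i)))) (cyc-conj {g = h} {g} hg gh (ρ ∘ ζ) (∘-Inj injρ injζ)))))

  Φ-long-cycle : (π : Fin (suc n) → Fin (suc n)) → Inj π → cyc π ≡ 1 →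
    pos (suc (suc n)) * (pos (suc n) * Φ π) ≡ rising q (suc (suc n)) - rising (q - pos (suc n)) (suc (suc n))
  Φ-long-cycle {n} π inj one with long-cycle-conj-rot π inj one zero
  ... | g , injg , _ , conj = trans (cong (λ x → pos (suc (suc n)) * (pos (suc n) * x)) (Φ-conj {π = π} {rot} rot-Inj injg conj)) (Φ-rot n)

  -- The product q (q - 1) ⋯ (q - m) with the sign of every factor changed is the rising product at
  -- -q, so its coefficients are again Stirling numbers up to sign.
  rising-reflect : ∀ m → rising (q - pos m) (suc m) ≡ -1ℤ ^ suc m * rising (- q) (suc m)
  rising-reflect zero = base q
    where
    base : ∀ q → (q - 0ℤ) * 1ℤ ≡ -1ℤ * 1ℤ * ((- q) * 1ℤ)
    base = solve-∀
  rising-reflect (suc m) = begin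
    (q - pos (suc m)) * rising (q - pos (suc m) + 1ℤ) (suc m)
      ≡⟨ cong (λ x → (q - pos (suc m)) * rising x (suc m)) (shift q (pos m)) ⟩
    (q - pos (suc m)) * rising (q - pos m) (suc m)
      ≡⟨ cong ((q - pos (suc m)) *_) (rising-reflect m) ⟩
    (q - pos (suc m)) * (-1ℤ ^ suc m * rising (- q) (suc m))
      ≡⟨ rearrange q (pos (suc m)) (-1ℤ ^ suc m) (rising (- q) (suc m)) ⟩
    -1ℤ * -1ℤ ^ suc m * (rising (- q) (suc m) * (- q + pos (suc m)))
      ≡⟨ cong (-1ℤ * -1ℤ ^ suc m *_) (sym (rising-suc (- q) (suc m))) ⟩
    -1ℤ ^ suc (suc m) * rising (- q) (suc (suc m)) ∎
    where
    open ≡-Reasoning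
    shift : ∀ q m → q - (1ℤ + m) + 1ℤ ≡ q - m
    shift = solve-∀
    rearrange : ∀ q m s r → (q - m) * (s * r) ≡ -1ℤ * s * (r * (- q + m))
    rearrange = solve-∀

∑<-cong : ∀ m {f g : ℕ → ℤ} → (∀ k → k ℕ.< m → f k ≡ g k) → ∑< m f ≡ ∑< m g
∑<-cong zero    eq = refl
∑<-cong (suc m) eq = cong₂ _+_ (eq 0 (ℕ.s≤s ℕ.z≤n)) (∑<-cong m (λ k k<m → eq (suc k) (ℕ.s≤s k<m)))

∑-upTo : ∀ m (f : ℕ → ℤ) → ∑ (upTo m) f ≡ ∑< m f
∑-upTo m f = go m id
  where
  go : ∀ m (h : ℕ → ℕ) → ∑ (applyUpTo h m) f ≡ ∑< m (f ∘ h)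
  go zero    h = refl
  go (suc m) h = cong (f (h 0) +_) (go m (h ∘ suc))

∑<-∑-swap : ∀ m (xs : List A) (f : ℕ → A → ℤ) → ∑< m (λ k → ∑ xs (f k)) ≡ ∑ xs (λ x → ∑< m (λ k → f k x))
∑<-∑-swap m xs f = trans (sym (∑-upTo m _)) (trans (∑-swap (upTo m) xs f) (∑-cong xs (λ x → ∑-upTo m (λ k → f k x))))

∑<-*ˡ : ∀ m a (f : ℕ → ℤ) → ∑< m (λ k → a * f k) ≡ a * ∑< m f
∑<-*ˡ m a f = trans (sym (∑-upTo m _)) (trans (∑-*ˡ a (upTo m) f) (cong (a *_) (∑-upTo m f)))

∑<-+ : ∀ m (f g : ℕ → ℤ) → ∑< m (λ k → f k + g k) ≡ ∑< m f + ∑< m g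
∑<-+ m f g = trans (sym (∑-upTo m _)) (trans (∑-+ (upTo m) f g) (cong₂ _+_ (∑-upTo m f) (∑-upTo m g)))

∑<-linear : ∀ m x y z (f g h : ℕ → ℤ) →
  ∑< m (λ k → x * f k + (y * g k + z * h k)) ≡ x * ∑< m f + (y * ∑< m g + z * ∑< m h)
∑<-linear m x y z f g h = trans (∑<-+ m (λ k → x * f k) (λ k → y * g k + z * h k)) (cong₂ _+_ (∑<-*ˡ m x f)
  (trans (∑<-+ m (λ k → y * g k) (λ k → z * h k)) (cong₂ _+_ (∑<-*ˡ m y g) (∑<-*ˡ m z h))))

∑<-𝟙 : ∀ m c (g : ℕ → ℤ) → c ℕ.< m → ∑< m (λ k → 𝟙 (c ℕ.≟ k) * g k) ≡ g c
∑<-𝟙 (suc m) zero g _ = trans (cong (1ℤ * g 0 +_) (vanish m)) (simplify (g 0))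
  where
  vanish : ∀ m → ∑< m (λ k → 0ℤ) ≡ 0ℤ
  vanish m = trans (sym (∑-upTo m _)) (∑-zero (upTo m))
  simplify : ∀ x → 1ℤ * x + 0ℤ ≡ x
  simplify = solve-∀
∑<-𝟙 (suc m) (suc c) g (ℕ.s≤s c<m) = trans (ℤ.+-identityˡ _) (∑<-𝟙 m c (g ∘ suc) c<m)

-- Used with two choices of `g`: the powers of q, from which the coefficients are determined, and
-- `weight j`, which assembles the same coefficients into `F`.
∑-by-value : ∀ m (xs : List A) (w : A → ℤ) (c : A → ℕ) (g : ℕ → ℤ) → (∀ x → c x ℕ.< m) →
  ∑ xs (λ x → w x * g (c x)) ≡ ∑< m (λ k → ∑ xs (λ x → w x * 𝟙 (c x ℕ.≟ k)) * g k)
∑-by-value m xs w c g c<m = sym (begin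
  ∑< m (λ k → ∑ xs (λ x → w x * 𝟙 (c x ℕ.≟ k)) * g k)
    ≡⟨ ∑<-cong m (λ k _ → trans (sym (∑-*ʳ (g k) xs (λ x → w x * 𝟙 (c x ℕ.≟ k))))
         (∑-cong xs (λ x → ℤ.*-assoc (w x) (𝟙 (c x ℕ.≟ k)) (g k)))) ⟩
  ∑< m (λ k → ∑ xs (λ x → w x * (𝟙 (c x ℕ.≟ k) * g k)))
    ≡⟨ ∑<-∑-swap m xs (λ k x → w x * (𝟙 (c x ℕ.≟ k) * g k)) ⟩
  ∑ xs (λ x → ∑< m (λ k → w x * (𝟙 (c x ℕ.≟ k) * g k)))
    ≡⟨ ∑-cong xs (λ x → trans (∑<-*ˡ m (w x) (λ k → 𝟙 (c x ℕ.≟ k) * g k)) (cong (w x *_) (∑<-𝟙 m (c x) g (c<m x)))) ⟩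
  ∑ xs (λ x → w x * g (c x)) ∎)
  where open ≡-Reasoning

bounded : ∀ m (c : ℕ → ℤ) → ∃ λ b → ∀ k → k ℕ.< m → ℤ.∣ c k ∣ ℕ.< b
bounded zero c = 0 , λ _ ()
bounded (suc m) c with bounded m (c ∘ suc)
... | b , lt = suc ℤ.∣ c 0 ∣ ℕ.⊔ b ,
      λ { zero _ → ℕ.m≤m⊔n (suc ℤ.∣ c 0 ∣) b
        ; (suc k) (ℕ.s≤s k<m) → ℕ.≤-trans (lt k k<m) (ℕ.m≤n⊔m (suc ℤ.∣ c 0 ∣) b) }

-- Evaluate at an integer exceeding all coefficients in absolute value.
coefficients-zero : ∀ m (c : ℕ → ℤ) → (∀ q → ∑< m (λ k → c k * q ^ k) ≡ 0ℤ) → ∀ k → k ℕ.< m → c k ≡ 0ℤ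
coefficients-zero m c vanish with bounded m c
... | b , lt = go m c lt (vanish (pos b))
  where
  open ≡-Reasoning
  go : ∀ m (c : ℕ → ℤ) → (∀ k → k ℕ.< m → ℤ.∣ c k ∣ ℕ.< b) → ∑< m (λ k → c k * pos b ^ k) ≡ 0ℤ → ∀ k → k ℕ.< m → c k ≡ 0ℤ
  go (suc m) c lt eq = λ { zero _ → c0≡0 ; (suc k) (ℕ.s≤s k<m) → go m (c ∘ suc) (λ k k<m → lt (suc k) (ℕ.s≤s k<m)) Y≡0 k k<m }
    where
    Y = ∑< m (λ k → c (suc k) * pos b ^ k)
    split : c 0 + pos b * Y ≡ 0ℤ
    split = begin
      c 0 + pos b * Y
        ≡⟨ cong₂ _+_ (sym (ℤ.*-identityʳ (c 0))) (sym (∑<-*ˡ m (pos b) (λ k → c (suc k) * pos b ^ k))) ⟩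
      c 0 * 1ℤ + ∑< m (λ k → pos b * (c (suc k) * pos b ^ k))
        ≡⟨ cong (c 0 * 1ℤ +_) (∑<-cong m (λ k _ → swap (pos b) (c (suc k)) (pos b ^ k))) ⟩
      ∑< (suc m) (λ k → c k * pos b ^ k)
        ≡⟨ eq ⟩
      0ℤ ∎
      where
      swap : ∀ b c p → b * (c * p) ≡ c * (b * p)
      swap = solve-∀
    c0≡ : c 0 ≡ - (pos b * Y)
    c0≡ = trans (move (c 0) (pos b * Y)) (trans (cong (_- pos b * Y) split) (ℤ.+-identityˡ _))
      where
      move : ∀ x y → x ≡ x + y - y
      move = solve-∀
    -- `c 0` is a multiple of `b` and smaller than `b` in absolute value, which forces `Y` to be 0.
    small : b ℕ.* ℤ.∣ Y ∣ ℕ.< b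
    small = subst (ℕ._< b) (trans (cong ℤ.∣_∣ c0≡) (trans (ℤ.∣-i∣≡∣i∣ (pos b * Y)) (ℤ.∣i*j∣≡∣i∣*∣j∣ (pos b) Y))) (lt 0 (ℕ.s≤s ℕ.z≤n))
    Y≡0 : Y ≡ 0ℤ
    Y≡0 with ℤ.∣ Y ∣ in ∣Y∣
    ... | zero  = ℤ.∣i∣≡0⇒i≡0 ∣Y∣
    ... | suc y = contradiction (subst (λ z → b ℕ.* z ℕ.< b) ∣Y∣ small) (ℕ.≤⇒≯ (ℕ.m≤m*n b (suc y)))
    c0≡0 : c 0 ≡ 0ℤ
    c0≡0 = trans c0≡ (cong -_ (trans (cong (pos b *_) Y≡0) (ℤ.*-zeroʳ (pos b))))

cyc-≤ : (σ : Fin n → Fin n) → cyc σ ℕ.≤ n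
cyc-≤ {zero} σ = ℕ.z≤n
cyc-≤ {suc n} σ = ℕ.+-mono-≤ (fixes0-≤ (σ zero)) (cyc-≤ (contract σ))
  where
  fixes0-≤ : ∀ z → fixes0 {n} z ℕ.≤ 1
  fixes0-≤ zero    = ℕ.≤-refl
  fixes0-≤ (suc _) = ℕ.z≤n

neg-^ : ∀ q k → (- q) ^ k ≡ -1ℤ ^ k * q ^ k
neg-^ q zero = refl
neg-^ q (suc k) = trans (cong ((- q) *_) (neg-^ q k)) (rearrange q (-1ℤ ^ k) (q ^ k))
  where
  rearrange : ∀ q s p → (- q) * (s * p) ≡ -1ℤ * s * (q * p)
  rearrange = solve-∀

longCycles : (Fin n → Fin n) → ℕ → ℤ
longCycles {n} π k = ∑ (Sym n) (λ ζ → 𝟙 (cyc ζ ℕ.≟ 1) * 𝟙 (cyc (π ∘ ζ) ℕ.≟ k))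

stirling : ℕ → ℕ → ℤ
stirling m k = ∑ (Sym m) (λ σ → 1ℤ * 𝟙 (cyc σ ℕ.≟ k))

-- For π the identity and S empty all signs are 1 and X counts permutations by their cycles; `X-∅`
-- gives its value.
rising-expand : ∀ m q → rising q m ≡ ∑< (suc m) (λ k → stirling m k * q ^ k)
rising-expand m q = begin
  rising q m
    ≡⟨ sym (Evaluation.X-∅ q {m} id id) ⟩
  ∑ (Sym m) (λ σ → ε σ (λ _ → false) * q ^ cyc σ)
    ≡⟨ ∑-cong (Sym m) (λ σ → cong (_* q ^ cyc σ) (ε-∅ σ)) ⟩
  ∑ (Sym m) (λ σ → 1ℤ * q ^ cyc σ)
    ≡⟨ ∑-by-value (suc m) (Sym m) (λ _ → 1ℤ) cyc (q ^_) (λ σ → ℕ.s≤s (cyc-≤ σ)) ⟩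
  ∑< (suc m) (λ k → stirling m k * q ^ k) ∎
  where open ≡-Reasoning

-- The rising product at q contributes the Stirling number, the reflected one subtracts it with the
-- sign (-1)^(n+2) from `rising-reflect` and (-1)^k from the powers of -q.
coefficient-identity : (π : Fin (suc n) → Fin (suc n)) → Inj π → cyc π ≡ 1 → ∀ k → k ℕ.< suc (suc (suc n)) →
  pos (suc (suc n)) * (pos (suc n) * longCycles π k) ≡ (1ℤ - -1ℤ ^ suc (suc n) * -1ℤ ^ k) * stirling (suc (suc n)) k
coefficient-identity {n} π inj one k k<M = trans (move (L k) (R k)) (trans (cong (_+ R k) (coefficients-zero M (λ k → L k - R k) vanish k k<M)) (ℤ.+-identityˡ (R k)))
  where
  open ≡-Reasoning
  M = suc (suc (suc n))
  c = pos (suc (suc n))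
  d = pos (suc n)
  s = -1ℤ ^ suc (suc n)
  L R : ℕ → ℤ
  L k = c * (d * longCycles π k)
  R k = (1ℤ - s * -1ℤ ^ k) * stirling (suc (suc n)) k
  move : ∀ x y → x ≡ x - y + y
  move = solve-∀
  vanish : ∀ q → ∑< M (λ k → (L k - R k) * q ^ k) ≡ 0ℤ
  vanish q = begin
    ∑< M (λ k → (L k - R k) * q ^ k)
      ≡⟨ ∑<-cong M (λ k _ → expand c d s (longCycles π k) (stirling (suc (suc n)) k) (q ^ k) (-1ℤ ^ k) ((- q) ^ k) (neg-^ q k)) ⟩
    ∑< M (λ k → c * d * (longCycles π k * q ^ k) + (-1ℤ * (stirling (suc (suc n)) k * q ^ k) + s * (stirling (suc (suc n)) k * (- q) ^ k)))
      ≡⟨ ∑<-linear M (c * d) -1ℤ s (λ k → longCycles π k * q ^ k) (λ k → stirling (suc (suc n)) k * q ^ k) (λ k → stirling (suc (suc n)) k * (- q) ^ k) ⟩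
    c * d * ∑< M (λ k → longCycles π k * q ^ k) + (-1ℤ * ∑< M (λ k → stirling (suc (suc n)) k * q ^ k) + s * ∑< M (λ k → stirling (suc (suc n)) k * (- q) ^ k))
      ≡⟨ cong₂ (λ x y → c * d * x + y)
           (sym (∑-by-value M (Sym (suc n)) (λ ζ → 𝟙 (cyc ζ ℕ.≟ 1)) (λ ζ → cyc (π ∘ ζ)) (q ^_) (λ ζ → ℕ.s≤s (ℕ.m≤n⇒m≤1+n (cyc-≤ (π ∘ ζ))))))
           (cong₂ (λ x y → -1ℤ * x + s * y) (sym (rising-expand (suc (suc n)) q)) (sym (rising-expand (suc (suc n)) (- q)))) ⟩
    c * d * Evaluation.Φ q π + (-1ℤ * r + s * r′)
      ≡⟨ cong (_+ (-1ℤ * r + s * r′)) (trans (ℤ.*-assoc c d (Evaluation.Φ q π)) (trans (Φ-long-cycle q π inj one)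
           (cong (λ x → r - x) (rising-reflect q (suc n))))) ⟩
    r - s * r′ + (-1ℤ * r + s * r′)
      ≡⟨ cancel r (s * r′) ⟩
    0ℤ ∎
    where
    r  = rising q (suc (suc n))
    r′ = rising (- q) (suc (suc n))
    cancel : ∀ x y → x - y + (-1ℤ * x + y) ≡ 0ℤ
    cancel = solve-∀
    expand : ∀ c d s a b p t p′ → p′ ≡ t * p →
      (c * (d * a) - (1ℤ - s * t) * b) * p ≡ c * d * (a * p) + (-1ℤ * (b * p) + s * (b * p′))
    expand c d s a b p t _ refl = ring c d s a b p t
      where
      ring : ∀ c d s a b p t → (c * (d * a) - (1ℤ - s * t) * b) * p ≡ c * d * (a * p) + (-1ℤ * (b * p) + s * (b * (t * p)))
      ring = solve-∀

-- The identity of the statement, coefficient by coefficient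

double-choose : ∀ n → 2 ℕ.* (suc n C 2) ≡ suc n ℕ.* n
double-choose zero = refl
double-choose (suc n) = begin
  2 ℕ.* (suc (suc n) C 2)
    ≡⟨ cong (2 ℕ.*_) (sym (nCk+nC[k+1]≡[n+1]C[k+1] (suc n) 1)) ⟩
  2 ℕ.* (suc n C 1 ℕ.+ suc n C 2)
    ≡⟨ ℕ.*-distribˡ-+ 2 (suc n C 1) (suc n C 2) ⟩
  2 ℕ.* (suc n C 1) ℕ.+ 2 ℕ.* (suc n C 2)
    ≡⟨ cong₂ (λ x y → 2 ℕ.* x ℕ.+ y) (nC1≡n (suc n)) (double-choose n) ⟩
  2 ℕ.* suc n ℕ.+ suc n ℕ.* n
    ≡⟨ cong (ℕ._+ suc n ℕ.* n) (ℕ.*-comm 2 (suc n)) ⟩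
  suc n ℕ.* 2 ℕ.+ suc n ℕ.* n
    ≡⟨ sym (ℕ.*-distribˡ-+ (suc n) 2 n) ⟩
  suc n ℕ.* suc (suc n)
    ≡⟨ ℕ.*-comm (suc n) (suc (suc n)) ⟩
  suc (suc n) ℕ.* suc n ∎
  where open ≡-Reasoning

paritySign : ℕ → ℤ
paritySign zero    = 1ℤ
paritySign (suc _) = -1ℤ

-1^-parity : ∀ k → -1ℤ ^ k ≡ paritySign (k % 2)
-1^-parity zero          = refl
-1^-parity (suc zero)    = refl
-1^-parity (suc (suc k)) = trans (square (-1ℤ ^ k)) (-1^-parity k)
  where
  square : ∀ x → -1ℤ * (-1ℤ * x) ≡ x
  square = solve-∀

pos-sumP : (f : A → Poly) (xs : List A) (j : ℕ) → pos (sumP (map f xs) j) ≡ ∑ xs (λ x → pos (f x j))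
pos-sumP f [] j = refl
pos-sumP f (x ∷ xs) j = trans (ℤ.pos-+ (f x j) _) (cong (pos (f x j) +_) (pos-sumP f xs j))

weight : ℕ → ℕ → ℤ
weight j k = pos (zpow ((k ℕ.∸ 1) / 2) j)

if-𝟙 : {P : Set} (d : Dec P) (x : ℤ) → (if does d then x else 0ℤ) ≡ 𝟙 d * x
if-𝟙 (yes _) x = sym (ℤ.*-identityˡ x)
if-𝟙 (no _)  x = refl

pos-F : (π : Fin n → Fin n) → Inj π → ∀ j m → n ℕ.< m →
  pos (F π j) ≡ ∑< m (λ k → longCycles π k * weight j k)
pos-F {n} π inj j m n<m = begin
  pos (F π j)
    ≡⟨ pos-sumP (λ ζ → zpow ((cycles (ζ · π) ℕ.∸ 1) / 2)) (Q n) j ⟩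
  ∑ (Q n) (λ ζ → weight j (cycles (ζ · π)))
    ≡⟨ ∑-filterB (λ ζ → cycles ζ ≡ᵇ 1) (Sym n) (λ ζ → weight j (cycles (ζ · π))) ⟩
  ∑ (Sym n) (λ ζ → if cycles ζ ≡ᵇ 1 then weight j (cycles (ζ · π)) else 0ℤ)
    ≡⟨ ∑-cong-All (Sym-Inj n) (λ ζ injζ → trans
         (cong₂ (λ x y → if x ≡ᵇ 1 then weight j y else 0ℤ) (cycles≡cyc ζ injζ) (cycles≡cyc (π ∘ ζ) (∘-Inj inj injζ)))
         -- The decision `cyc ζ ≟ 1` computes to the Boolean test `cyc ζ ≡ᵇ 1` of the filter.
         (if-𝟙 (cyc ζ ℕ.≟ 1) (weight j (cyc (π ∘ ζ))))) ⟩
  ∑ (Sym n) (λ ζ → 𝟙 (cyc ζ ℕ.≟ 1) * weight j (cyc (π ∘ ζ)))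
    ≡⟨ ∑-by-value m (Sym n) (λ ζ → 𝟙 (cyc ζ ℕ.≟ 1)) (λ ζ → cyc (π ∘ ζ)) (weight j) (λ ζ → ℕ.≤-<-trans (cyc-≤ (π ∘ ζ)) n<m) ⟩
  ∑< m (λ k → longCycles π k * weight j k) ∎
  where open ≡-Reasoning

pos-stirling1 : ∀ m k → pos (stirling1 m k) ≡ stirling m k
pos-stirling1 m k = trans (pos-count (λ σ → cycles σ ≡ᵇ k) (Sym m)) (∑-cong-All (Sym-Inj m) (λ σ inj →
  trans (cong (λ x → if x ≡ᵇ k then 1ℤ else 0ℤ) (cycles≡cyc σ inj)) (sym (ℤ.*-identityˡ (𝟙 (cyc σ ℕ.≟ k))))))

selected : ℕ → ℕ → Bool
selected n k = (1 ≤ᵇ k) ∧ (k % 2 ≡ᵇ n % 2)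

pos-RHS : ∀ n j → pos (RHS n j) ≡ ∑< (suc (suc n)) (λ k → if selected n k then stirling (suc n) k * weight j k else 0ℤ)
pos-RHS n j = begin
  pos (RHS n j)
    ≡⟨ pos-sumP (λ k → stirling1 (suc n) k *P zpow ((k ℕ.∸ 1) / 2)) (filterB (selected n) (upTo (n ℕ.+ 2))) j ⟩
  ∑ (filterB (selected n) (upTo (n ℕ.+ 2))) (λ k → pos (stirling1 (suc n) k ℕ.* zpow ((k ℕ.∸ 1) / 2) j))
    ≡⟨ ∑-cong (filterB (selected n) (upTo (n ℕ.+ 2))) (λ k → trans (ℤ.pos-* (stirling1 (suc n) k) _)
         (cong (_* weight j k) (pos-stirling1 (suc n) k))) ⟩
  ∑ (filterB (selected n) (upTo (n ℕ.+ 2))) (λ k → stirling (suc n) k * weight j k)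
    ≡⟨ ∑-filterB (selected n) (upTo (n ℕ.+ 2)) (λ k → stirling (suc n) k * weight j k) ⟩
  ∑ (upTo (n ℕ.+ 2)) term
    ≡⟨ ∑-upTo (n ℕ.+ 2) term ⟩
  ∑< (n ℕ.+ 2) term
    ≡⟨ cong (λ m → ∑< m term) (ℕ.+-comm n 2) ⟩
  ∑< (suc (suc n)) term ∎
  where
  open ≡-Reasoning
  term : ℕ → ℤ
  term k = if selected n k then stirling (suc n) k * weight j k else 0ℤ

stirling-zero : ∀ m → stirling (suc m) 0 ≡ 0ℤ
stirling-zero m = trans (∑-cong (Sym (suc m)) (λ σ → trans (ℤ.*-identityˡ (𝟙 (cyc σ ℕ.≟ 0)))
  (𝟙-no (cyc σ ℕ.≟ 0) (λ eq → contradiction (trans (sym eq) (proj₂ (cyc-positive σ))) λ ())))) (∑-zero (Sym (suc m)))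

module _ {N : ℕ} (π : Fin (suc N) → Fin (suc N)) (inj : Inj π) (one : cyc π ≡ 1) where
  private
    n′ = suc N
    choose = pos (suc n′ C 2)

  doubled : ∀ k → k ℕ.< suc (suc n′) →
    pos 2 * (choose * longCycles π k) ≡ (1ℤ - paritySign (suc n′ % 2) * paritySign (k % 2)) * stirling (suc n′) k
  doubled k k<m = begin
    pos 2 * (choose * longCycles π k)
      ≡⟨ sym (ℤ.*-assoc (pos 2) choose (longCycles π k)) ⟩
    pos 2 * choose * longCycles π k
      ≡⟨ cong (_* longCycles π k) (trans (sym (ℤ.pos-* 2 (suc n′ C 2))) (trans (cong pos (double-choose n′)) (ℤ.pos-* (suc n′) n′))) ⟩
    pos (suc n′) * pos n′ * longCycles π k
      ≡⟨ ℤ.*-assoc (pos (suc n′)) (pos n′) (longCycles π k) ⟩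
    pos (suc n′) * (pos n′ * longCycles π k)
      ≡⟨ coefficient-identity π inj one k k<m ⟩
    (1ℤ - -1ℤ ^ suc n′ * -1ℤ ^ k) * stirling (suc n′) k
      ≡⟨ cong₂ (λ x y → (1ℤ - x * y) * stirling (suc n′) k) (-1^-parity (suc n′)) (-1^-parity k) ⟩
    (1ℤ - paritySign (suc n′ % 2) * paritySign (k % 2)) * stirling (suc n′) k ∎
    where open ≡-Reasoning

  -- The factor in `doubled` is 2 if k and n′ have the same parity and 0 otherwise, so a common
  -- factor 2 can be cancelled.
  choose-longCycles : ∀ k → k ℕ.< suc (suc n′) →
    choose * longCycles π k ≡ (if k % 2 ≡ᵇ n′ % 2 then stirling (suc n′) k else 0ℤ)
  choose-longCycles k k<m = ℤ.*-cancelˡ-≡ (pos 2) _ _ (trans (doubled k k<m) (by-parity (parity k) (parity-suc n′) (stirling (suc n′) k)))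
    where
    parity : ∀ k → k % 2 ≡ 0 ⊎ k % 2 ≡ 1
    parity zero          = inj₁ refl
    parity (suc zero)    = inj₂ refl
    parity (suc (suc k)) = parity k
    parity-suc : ∀ m → (m % 2 ≡ 0 × suc m % 2 ≡ 1) ⊎ (m % 2 ≡ 1 × suc m % 2 ≡ 0)
    parity-suc zero          = inj₁ (refl , refl)
    parity-suc (suc zero)    = inj₂ (refl , refl)
    parity-suc (suc (suc m)) = parity-suc m
    same : ∀ x → (1ℤ - -1ℤ) * x ≡ pos 2 * x
    same = solve-∀
    by-parity : k % 2 ≡ 0 ⊎ k % 2 ≡ 1 → (n′ % 2 ≡ 0 × suc n′ % 2 ≡ 1) ⊎ (n′ % 2 ≡ 1 × suc n′ % 2 ≡ 0) → ∀ x →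
      (1ℤ - paritySign (suc n′ % 2) * paritySign (k % 2)) * x ≡ pos 2 * (if k % 2 ≡ᵇ n′ % 2 then x else 0ℤ)
    by-parity (inj₁ p) (inj₁ (r , r′)) x rewrite p | r | r′ = refl
    by-parity (inj₁ p) (inj₂ (r , r′)) x rewrite p | r | r′ = ℤ.*-zeroˡ x
    by-parity (inj₂ p) (inj₁ (r , r′)) x rewrite p | r | r′ = ℤ.*-zeroˡ x
    by-parity (inj₂ p) (inj₂ (r , r′)) x rewrite p | r | r′ = refl

  term-identity : ∀ j k → k ℕ.< suc (suc n′) →
    choose * (longCycles π k * weight j k) ≡ (if selected n′ k then stirling (suc n′) k * weight j k else 0ℤ)
  term-identity j k k<m = trans (sym (ℤ.*-assoc choose (longCycles π k) (weight j k)))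
    (trans (cong (_* weight j k) (choose-longCycles k k<m)) (select k))
    where
    select : ∀ k → (if k % 2 ≡ᵇ n′ % 2 then stirling (suc n′) k else 0ℤ) * weight j k
      ≡ (if selected n′ k then stirling (suc n′) k * weight j k else 0ℤ)
    -- `selected` excludes k = 0, while the truncated `0 ∸ 1` gives it the weight of exponent 0; the
    -- term vanishes because no permutation of a nonempty set has 0 cycles.
    select zero with 0 ≡ᵇ n′ % 2
    ... | true  = cong (_* weight j 0) (stirling-zero n′)
    ... | false = refl
    select (suc k) with suc k % 2 ≡ᵇ n′ % 2
    ... | true  = refl
    ... | false = refl

theorem4p2 : (n : ℕ) → n ≥ 1 → (π : Fin n → Fin n) → isPerm π ≡ true → cycles π ≡ 1 →
    (j : ℕ) → ((suc n C 2) *P F π) j ≡ RHS n j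
theorem4p2 n@(suc N) _ π perm one j = ℤ.+-injective (begin
  pos ((suc n C 2) ℕ.* F π j)
    ≡⟨ ℤ.pos-* (suc n C 2) (F π j) ⟩
  pos (suc n C 2) * pos (F π j)
    ≡⟨ cong (pos (suc n C 2) *_) (pos-F π inj j m (ℕ.m≤n⇒m≤1+n ℕ.≤-refl)) ⟩
  pos (suc n C 2) * ∑< m (λ k → longCycles π k * weight j k)
    ≡⟨ sym (∑<-*ˡ m (pos (suc n C 2)) (λ k → longCycles π k * weight j k)) ⟩
  ∑< m (λ k → pos (suc n C 2) * (longCycles π k * weight j k))
    ≡⟨ ∑<-cong m (term-identity π inj (trans (sym (cycles≡cyc π inj)) one) j) ⟩
  ∑< m (λ k → if selected n k then stirling (suc n) k * weight j k else 0ℤ)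
    ≡⟨ sym (pos-RHS n j) ⟩
  pos (RHS n j) ∎)
  where
  open ≡-Reasoning
  -- This is n + 2: both sides are summed over k ≤ n + 1, the range of the Stirling numbers.
  m = suc (suc (suc N))
  inj : Inj π
  inj = isPerm⇒Inj π perm
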